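{- Let $n$ be a positive integer and let $k$ be an even integer with $n/2+1\le k\le n-1$. Then the graph $H_{n,k}$ is uniquely vector colorable.
   Context: For $x,y\in\mathbb{Z}_2^n$, the weight of $x$ is its number of nonzero coordinates and $d(x,y)$ denotes Hamming distance. $H_{n,k}$ is the graph whose vertices are the even-weight elements of $\mathbb{Z}_2^n$, with $x\sim y$ iff $x+y$ has weight exactly $k$ (addition is bitwise XOR). A vector $t$-coloring of a graph $G$ (with $t\ge 2$) is an assignment $i\mapsto p_i$ of unit vectors in some $\mathbb{R}^d$ to the vertices of $G$ such that $\langle p_i,p_j\rangle\le -1/(t-1)$ whenever $i\sim j$. The vector chromatic number $\chi_v(G)$ is the smallest $t\ge 2$ for which a vector $t$-coloring exists; a vector $\chi_v(G)$-coloring is called optimal. $G$ is uniquely vector colorable (UVC) if any two optimal vector colorings $i\mapsto p_i\in\mathbb{R}^d$ and $i\mapsto q_i\in\mathbb{R}^{d'}$ of $G$ have the same Gram matrix, i.e. $\langle p_i,p_j\rangle=\langle q_i,q_j\rangle$ for all vertices $i,j$. -}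

module Defs where

open import Algebra.Apartness.Structures using (IsHeytingField)
open import Algebra.Bundles using (CommutativeRing)
import Algebra.Properties.Semiring.Mult as SemiringMult
import Algebra.Properties.Semiring.Sum as SemiringSum
open import Data.Bool.Base using (Bool; true; _xor_)
open import Data.Bool.Properties using (xor-comm) renaming (_≟_ to _≟ᵇ_)
open import Data.Empty using (⊥-elim)
open import Data.Nat.Base as ℕ using (ℕ)
open import Data.Nat.Divisibility using (_∣_)
open import Data.Product.Base using (_×_; _,_; proj₁; ∃; ∃-syntax)
open import Data.Refinement using (Refinement; value)
open import Data.Sum.Base using (_⊎_; inj₁; inj₂)
open import Data.Vec.Base using (Vec; count; zipWith)
open import Data.Vec.Functional using (Vector)
open import Data.Vec.Properties using (zipWith-comm)
open import Level using (Level; suc; _⊔_)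
open import Relation.Binary.Core using (Rel)
open import Relation.Binary.Definitions using (Cotransitive; Symmetric)
open import Relation.Binary.PropositionalEquality using (_≡_; cong; trans)
open import Relation.Binary.Structures using (IsStrictPartialOrder)
open import Relation.Nullary.Negation using (¬_)

-- The real numbers, axiomatised as a Cauchy-complete Archimedean ordered
-- field.  Classically these axioms determine ℝ up to unique isomorphism.
-- Constructively, the apartness and cotransitivity axioms take the place of
-- a decidable linear order.
record RealField c ℓ₁ ℓ₂ : Set (suc (c ⊔ ℓ₁ ⊔ ℓ₂)) where
  infix  8 -_
  infixl 7 _*_
  infixl 6 _+_
  infix  4 _≈_ _<_ _≤_ _#_
  field
    Carrier : Set c
    _≈_     : Rel Carrier ℓ₁
    _<_     : Rel Carrier ℓ₂
    _+_ _*_ : Carrier → Carrier → Carrier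
    -_      : Carrier → Carrier
    0# 1#   : Carrier

  _#_ : Rel Carrier ℓ₂
  x # y = x < y ⊎ y < x

  _≤_ : Rel Carrier ℓ₂
  x ≤ y = ¬ (y < x)

  field
    isHeytingField       : IsHeytingField _≈_ _#_ _+_ _*_ -_ 0# 1#
    isStrictPartialOrder : IsStrictPartialOrder _≈_ _<_
    <-cotrans            : Cotransitive _<_
    +-monoˡ-<            : ∀ {x y} z → x < y → x + z < y + z
    *-pos                : ∀ {x y} → 0# < x → 0# < y → 0# < x * y
    0<1                  : 0# < 1#

  open IsHeytingField isHeytingField public
    hiding (isEquivalence; refl; sym; trans; reflexive; isPartialEquivalence)
  open IsStrictPartialOrder isStrictPartialOrder public
    using (isEquivalence; <-respˡ-≈; <-respʳ-≈; module Eq)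
    renaming (irrefl to <-irrefl; trans to <-trans; asym to <-asym)

  commutativeRing : CommutativeRing c ℓ₁
  commutativeRing = record
    { isCommutativeRing = IsHeytingField.isCommutativeRing isHeytingField }

  open CommutativeRing commutativeRing public using (semiring)
  open SemiringMult semiring public using () renaming (_×_ to _·_)
  open SemiringSum semiring public using (sum)

  -- The bound is required for all pairs m, n, hence holds for ∣ s m - s n ∣.
  IsCauchy : (ℕ → Carrier) → Set (c ⊔ ℓ₂)
  IsCauchy s = ∀ ε → 0# < ε →
    ∃[ N ] ∀ m n → N ℕ.≤ m → N ℕ.≤ n → s m - s n < ε

  _ConvergesTo_ : (ℕ → Carrier) → Carrier → Set (c ⊔ ℓ₂)
  s ConvergesTo x = ∀ ε → 0# < ε →
    ∃[ N ] ∀ n → N ℕ.≤ n → (s n - x < ε) × (x - s n < ε)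

  field
    archimedean : ∀ x → ∃[ n ] x < n · 1#
    complete    : ∀ s → IsCauchy s → ∃ (s ConvergesTo_)

  2# : Carrier
  2# = 1# + 1#

  1<2 : 1# < 2#
  1<2 = <-respˡ-≈ (+-identityˡ 1#) (+-monoˡ-< 1# 0<1)

  2≤t⇒1<t : ∀ {t} → 2# ≤ t → 1# < t
  2≤t⇒1<t {t} 2≤t with <-cotrans 1<2 t
  ... | inj₁ 1<t = 1<t
  ... | inj₂ t<2 = ⊥-elim (2≤t t<2)

  1/[_-1] : ∀ t → 2# ≤ t → Carrier
  1/[ t -1] 2≤t = proj₁ (#⇒invertible {t} {1#} (inj₂ (2≤t⇒1<t 2≤t)))

  ⟨_,_⟩ : ∀ {d} → Vector Carrier d → Vector Carrier d → Carrier
  ⟨ u , v ⟩ = sum (λ a → u a * v a)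

-- Undirected graphs.  Loops are not excluded, because H n 0 has them.
record Graph : Set₁ where
  infix 4 _∼_
  field
    Vertex : Set
    _∼_    : Rel Vertex _
    ∼-sym  : Symmetric _∼_

module VectorColoring {c ℓ₁ ℓ₂} (ℝ : RealField c ℓ₁ ℓ₂) (G : Graph) where
  open RealField ℝ
  open Graph G

  record IsVectorColoring (t : Carrier) {d : ℕ} (p : Vertex → Vector Carrier d)
         : Set (ℓ₁ ⊔ ℓ₂) where
    field
      2≤t      : 2# ≤ t
      unit     : ∀ i → ⟨ p i , p i ⟩ ≈ 1#
      adjacent : ∀ i j → i ∼ j → ⟨ p i , p j ⟩ ≤ - (1/[ t -1] 2≤t)

  VectorColorable : Carrier → Set (c ⊔ ℓ₁ ⊔ ℓ₂)
  VectorColorable t =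
    ∃[ d ] ∃ λ (p : Vertex → Vector Carrier d) → IsVectorColoring t p

  IsVectorChromaticNumber : Carrier → Set (c ⊔ ℓ₁ ⊔ ℓ₂)
  IsVectorChromaticNumber t =
    VectorColorable t × (∀ t′ → VectorColorable t′ → t ≤ t′)

  IsOptimal : ∀ {d} → (Vertex → Vector Carrier d) → Set (c ⊔ ℓ₁ ⊔ ℓ₂)
  IsOptimal p = ∃[ t ] IsVectorChromaticNumber t × IsVectorColoring t p

  UniquelyVectorColorable : Set (c ⊔ ℓ₁ ⊔ ℓ₂)
  UniquelyVectorColorable =
    ∀ {d d′} (p : Vertex → Vector Carrier d) (q : Vertex → Vector Carrier d′) →
    IsOptimal p → IsOptimal q → ∀ i j → ⟨ p i , p j ⟩ ≈ ⟨ q i , q j ⟩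

open VectorColoring public using (UniquelyVectorColorable)

-- ℤ₂ⁿ is Vec Bool n, with true as the nonzero element of ℤ₂.
weight : ∀ {n} → Vec Bool n → ℕ
weight = count (_≟ᵇ true)

infixl 6 _⊕_
_⊕_ : ∀ {n} → Vec Bool n → Vec Bool n → Vec Bool n
_⊕_ = zipWith _xor_

H : ℕ → ℕ → Graph
H n k = record
  { Vertex = Refinement (Vec Bool n) (λ x → 2 ∣ weight x)
  ; _∼_    = λ x y → weight (value x ⊕ value y) ≡ k
  ; ∼-sym  = λ {x} {y} → trans (cong weight (zipWith-comm xor-comm (value y) (value x)))
  }

{-# OPTIONS --safe #-}

-- Put the vertices in bijection with x ∈ ℤ₂ⁿ⁻¹ by deleting the first coordinate; then H n k is a
-- Cayley graph of ℤ₂ⁿ⁻¹ whose eigenvalue at S is the Krawtchouk number K (n − w) w k, w = weight S.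
-- It is minimal exactly for w = 1 and w = n − 1, where it equals −(2k − n)/n times the degree.
--
-- The ±1 vectors of the vertices, scaled to unit length, form a vector colouring with
-- t = 1 + n/(2k − n).  Hence for an optimal colouring p adjacent inner products are at most
-- −(2k − n)/n, and by Plancherel a nonnegative combination of the ∣p̂ S∣², with coefficients the
-- eigenvalue gaps, is at most zero.  So p is a combination of the n characters of minimal
-- eigenvalue, and all adjacent inner products equal −(2k − n)/n.  For fixed x this makes
-- y ↦ ⟨ p x , p y ⟩ a signed sum ∑ᵢ ±cᵢ with prescribed values at distances 0 and k from x;
-- exchanging two coordinates shows that the cᵢ are all equal, so ⟨ p x , p y ⟩ depends only on x ⊕ y.
--
-- The eigenvalue gap comes from the three-term recurrence of K in w, through a quadratic energy
-- that decreases up to w = n/2.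
module Submission where

open import Defs
open import Algebra.Bundles using (CommutativeRing)
import Algebra.Properties.AbelianGroup as AbelianGroupProperties
import Algebra.Properties.Ring as RingProperties
import Algebra.Properties.Semiring.Mult as SemiringMult
import Algebra.Properties.Semiring.Sum as SemiringSum
import Algebra.Solver.Ring as RingSolver
open import Algebra.Solver.Ring.AlmostCommutativeRing using (fromCommutativeRing; _-Raw-AlmostCommutative⟶_)
open import Data.Bool.Base using (Bool; true; false; _xor_; not)
open import Data.Bool.Properties using (xor-same; xor-identityʳ; not-involutive) renaming (_≟_ to _≟ᵇ_)
open import Data.Fin.Base using (Fin; zero; suc)
open import Data.Integer.Base as ℤ using (ℤ; +_; -[1+_]; 0ℤ; 1ℤ; -1ℤ)
import Data.Integer.Properties as ℤ
open import Data.Irrelevant using () renaming ([_] to irrelevant)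
open import Data.Maybe.Base using (map)
open import Data.Nat.Base as ℕ using (ℕ; zero; suc; pred; s≤s; z≤n)
open import Data.Nat.Divisibility using (_∣_; divides; ∣m+n∣m⇒∣n; ∣-refl; _∣0; ∣m∣n⇒∣m+n; ∣1⇒≡1)
import Data.Nat.Properties as ℕ
open import Data.Product.Base using (_×_; _,_; proj₁; proj₂; ∃-syntax)
open import Data.Refinement using (Refinement; value; _,_)
open import Data.Sum.Base using (_⊎_; inj₁; inj₂; [_,_])
open import Data.Vec.Base using (Vec; []; _∷_; replicate; lookup; count)
import Data.Vec.Functional as Vector
open import Data.Vec.Functional using (Vector)
open import Function.Base using (_∘_)
open import Relation.Binary.PropositionalEquality as ≡ using (_≡_; _≢_)
import Relation.Binary.Reasoning.Setoid as SetoidReasoning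
open import Relation.Nullary.Decidable using (Dec; yes; no; recompute; dec⇒maybe)
open import Relation.Nullary.Negation using (contradiction; ¬_)

-- Krawtchouk numbers: recurrences and symmetry.

module Krawtchouk where
  open import Data.Integer.Base hiding (suc; pred)
  open import Data.Integer.Properties
  open import Data.Integer.Solver using (module +-*-Solver)
  open +-*-Solver
  open ≡ using (refl; sym; trans; cong; cong₂; subst; subst₂; module ≡-Reasoning)
  open ≡-Reasoning

  -- The k-th elementary symmetric polynomial of a signs +1 and b signs −1, i.e. the value at b of
  -- the k-th Krawtchouk polynomial on a + b points.
  K : ℕ → ℕ → ℕ → ℤ
  K zero    zero    zero    = 1ℤ
  K zero    zero    (suc k) = 0ℤ
  K zero    (suc b) zero    = K zero b zero
  K zero    (suc b) (suc k) = K zero b (suc k) - K zero b k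
  K (suc a) b       zero    = K a b zero
  K (suc a) b       (suc k) = K a b (suc k) + K a b k

  K-zero : ∀ a b → K a b 0 ≡ 1ℤ
  K-zero zero    zero    = refl
  K-zero zero    (suc b) = K-zero zero b
  K-zero (suc a) b       = K-zero a b

  -- `K` removes positive signs first, so the rule for a negative sign holds by definition only at
  -- `a = 0`. The two rules commute, which extends it to every `a` by induction.
  K-suc₂ : ∀ a b k → K a (suc b) (suc k) ≡ K a b (suc k) - K a b k
  K-suc₂ zero    b k       = refl
  K-suc₂ (suc a) b zero    = begin
    K a (suc b) 1 + K a (suc b) 0    ≡⟨ cong₂ _+_ (K-suc₂ a b 0) (trans (K-zero a (suc b)) (sym (K-zero a b))) ⟩
    K a b 1 - K a b 0 + K a b 0      ≡⟨ solve 2 (λ x y → x :- y :+ y := x :+ y :- y) refl (K a b 1) (K a b 0) ⟩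
    K a b 1 + K a b 0 - K a b 0      ∎
  K-suc₂ (suc a) b (suc k) = begin
    K a (suc b) (2 ℕ.+ k) + K a (suc b) (suc k)
      ≡⟨ cong₂ _+_ (K-suc₂ a b (suc k)) (K-suc₂ a b k) ⟩
    K a b (2 ℕ.+ k) - K a b (suc k) + (K a b (suc k) - K a b k)
      ≡⟨ solve 3 (λ x y z → x :- y :+ (y :- z) := x :+ y :- (y :+ z)) refl (K a b (2 ℕ.+ k)) (K a b (suc k)) (K a b k) ⟩
    K a b (2 ℕ.+ k) + K a b (suc k) - (K a b (suc k) + K a b k) ∎

  -- Flipping each of the a + b signs in turn reverses every monomial of degree k exactly k times.
  K-recurrence : ∀ a b k →
    + a * K (pred a) (suc b) k + + b * K (suc a) (pred b) k ≡ (+ a + + b - + 2 * + k) * K a b k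
  K-recurrence a b zero
    rewrite K-zero (pred a) (suc b) | K-zero a (pred b) | K-zero a b =
    solve 2 (λ x y → x :* con 1ℤ :+ y :* con 1ℤ := (x :+ y :- con (+ 2) :* con 0ℤ) :* con 1ℤ) refl (+ a) (+ b)
  K-recurrence zero zero (suc k) = sym (*-zeroʳ (0ℤ + 0ℤ - + 2 * + suc k))
  K-recurrence zero (suc b) (suc k) = begin
    0ℤ * K 0 (suc (suc b)) (suc k) + + suc b * (x + y)
      ≡⟨ solve 3 (λ b x y → con 0ℤ :+ (con 1ℤ :+ b) :* (x :+ y) := (x :+ y) :+ b :* (x :+ y)) refl (+ b) x y ⟩
    x + y + + b * (x + y)
      ≡⟨ cong (λ v → x + y + v) (lower b) ⟩
    x + y + (+ b * K 1 (pred b) (suc k) - + b * K 1 (pred b) k)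
      ≡⟨ cong (λ v → x + y + v) (cong₂ _-_ (drop0 (+ b * K 1 (pred b) (suc k)) (K-recurrence zero b (suc k))) (drop0 (+ b * K 1 (pred b) k) (K-recurrence zero b k))) ⟩
    x + y + ((0ℤ + + b - + 2 * + suc k) * x - (0ℤ + + b - + 2 * + k) * y)
      ≡⟨ solve 4 (λ b k x y → x :+ y :+ ((con 0ℤ :+ b :- con (+ 2) :* (con 1ℤ :+ k)) :* x :- (con 0ℤ :+ b :- con (+ 2) :* k) :* y)
           := (con 0ℤ :+ (con 1ℤ :+ b) :- con (+ 2) :* (con 1ℤ :+ k)) :* (x :- y)) refl (+ b) (+ k) x y ⟩
    (0ℤ + + suc b - + 2 * + suc k) * (x - y) ∎
    where
    x = K 0 b (suc k)
    y = K 0 b k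
    -- The factor `+ b` makes the default `pred 0 = 0` harmless: at `b = 0` both sides vanish.
    lower : ∀ b → + b * K 1 b (suc k) ≡ + b * K 1 (pred b) (suc k) - + b * K 1 (pred b) k
    lower zero    = refl
    lower (suc b) = trans (cong (+ suc b *_) (K-suc₂ 1 b k))
      (solve 3 (λ b x y → b :* (x :- y) := b :* x :- b :* y) refl (+ suc b) (K 1 b (suc k)) (K 1 b k))
    drop0 : ∀ v {w} → 0ℤ + v ≡ w → v ≡ w
    drop0 v eq = trans (sym (+-identityˡ v)) eq
  K-recurrence (suc a) b (suc k) = begin
    + suc a * K a (suc b) (suc k) + + b * (z + w)
      ≡⟨ solve 5 (λ a v b z w → (con 1ℤ :+ a) :* v :+ b :* (z :+ w) := v :+ (a :* v :+ b :* (z :+ w))) refl (+ a) (K a (suc b) (suc k)) (+ b) z w ⟩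
    K a (suc b) (suc k) + (+ a * K a (suc b) (suc k) + + b * (z + w))
      ≡⟨ cong₂ (λ u v → u + (v + + b * (z + w))) (K-suc₂ a b k) (lower a) ⟩
    x - y + (+ a * K (pred a) (suc b) (suc k) + + a * K (pred a) (suc b) k + + b * (z + w))
      ≡⟨ solve 7 (λ x y p q b z w → x :- y :+ (p :+ q :+ b :* (z :+ w)) := x :- y :+ ((p :+ b :* z) :+ (q :+ b :* w))) refl
           x y (+ a * K (pred a) (suc b) (suc k)) (+ a * K (pred a) (suc b) k) (+ b) z w ⟩
    x - y + ((+ a * K (pred a) (suc b) (suc k) + + b * z) + (+ a * K (pred a) (suc b) k + + b * w))
      ≡⟨ cong (λ v → x - y + v) (cong₂ _+_ (K-recurrence a b (suc k)) (K-recurrence a b k)) ⟩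
    x - y + ((+ a + + b - + 2 * + suc k) * x + (+ a + + b - + 2 * + k) * y)
      ≡⟨ solve 5 (λ a b k x y → x :- y :+ ((a :+ b :- con (+ 2) :* (con 1ℤ :+ k)) :* x :+ (a :+ b :- con (+ 2) :* k) :* y)
           := ((con 1ℤ :+ a) :+ b :- con (+ 2) :* (con 1ℤ :+ k)) :* (x :+ y)) refl (+ a) (+ b) (+ k) x y ⟩
    (+ suc a + + b - + 2 * + suc k) * (x + y) ∎
    where
    x = K a b (suc k)
    y = K a b k
    z = K (suc a) (pred b) (suc k)
    w = K (suc a) (pred b) k
    lower : ∀ a → + a * K a (suc b) (suc k) ≡ + a * K (pred a) (suc b) (suc k) + + a * K (pred a) (suc b) k
    lower zero    = refl
    lower (suc a) = *-distribˡ-+ (+ suc a) (K a (suc b) (suc k)) (K a (suc b) k)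

  -- Exchanging the two kinds of signs negates all variables, which multiplies a homogeneous
  -- polynomial of degree `k` by the `k`-th power of -1; the degree here is even.
  K-swap : ∀ a b j → K a b (j ℕ.+ j) ≡ K b a (j ℕ.+ j)
  K-swap a b j = trans (swap a b (j ℕ.+ j)) (trans (cong (_* K b a (j ℕ.+ j)) (parity-even j)) (*-identityˡ _))
    where
    parity : ℕ → ℤ
    parity zero    = 1ℤ
    parity (suc k) = - parity k
    parity-even : ∀ j → parity (j ℕ.+ j) ≡ 1ℤ
    parity-even zero = refl
    parity-even (suc j) rewrite ℕ.+-suc j j = trans (neg-involutive (parity (j ℕ.+ j))) (parity-even j)
    swap : ∀ a b k → K a b k ≡ parity k * K b a k
    swap zero zero zero    = refl
    swap zero zero (suc k) = sym (*-zeroʳ (- parity k))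
    swap a    b    zero    = trans (K-zero a b) (trans (sym (K-zero b a)) (sym (*-identityˡ _)))
    swap zero (suc b) (suc k) = trans (cong₂ _-_ (swap 0 b (suc k)) (swap 0 b k))
      (solve 3 (λ p x y → (:- p) :* x :- p :* y := (:- p) :* (x :+ y)) refl (parity k) (K b 0 (suc k)) (K b 0 k))
    swap (suc a) b (suc k) = trans (cong₂ _+_ (swap a b (suc k)) (swap a b k))
      (trans (solve 3 (λ p x y → (:- p) :* x :+ p :* y := (:- p) :* (x :- y)) refl (parity k) (K b a (suc k)) (K b a k))
        (cong (- parity k *_) (sym (K-suc₂ b a k))))

  -- Positivity and order lemmas for integers.

  0≤K : ∀ n k → 0ℤ ≤ K n 0 k
  0≤K zero zero = +≤+ z≤n
  0≤K zero (suc k) = +≤+ z≤n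
  0≤K (suc n) zero = 0≤K n zero
  0≤K (suc n) (suc k) = +-mono-≤ (0≤K n (suc k)) (0≤K n k)

  -- `K n 0 k` is the binomial coefficient `n` choose `k`.
  0<K : ∀ {n k} → k ℕ.≤ n → 0ℤ < K n 0 k
  0<K {n} {zero} _ rewrite K-zero n 0 = +<+ (s≤s z≤n)
  0<K {suc n} {suc k} (s≤s k≤n) = +-mono-≤-< (0≤K n (suc k)) (0<K k≤n)

  0≤i*j : ∀ {i j} → 0ℤ ≤ i → 0ℤ ≤ j → 0ℤ ≤ i * j
  0≤i*j {+ m} {+ n} _ _ = subst (0ℤ ≤_) (pos-* m n) (+≤+ z≤n)

  0<i*j : ∀ {i j} → 0ℤ < i → 0ℤ < j → 0ℤ < i * j
  0<i*j {+[1+ m ]} {+[1+ n ]} _ _ = +<+ (s≤s z≤n)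
  0<i*j {+0} (+<+ ())
  0<i*j {+[1+ m ]} {+0} _ (+<+ ())

  0≤i*i : ∀ i → 0ℤ ≤ i * i
  0≤i*i (+ n) = 0≤i*j {+ n} {+ n} (+≤+ z≤n) (+≤+ z≤n)
  0≤i*i -[1+ n ] = +≤+ z≤n

  0<i*j⇒0<j : ∀ {i j} → 0ℤ < i → 0ℤ < i * j → 0ℤ < j
  0<i*j⇒0<j {+[1+ m ]} {+[1+ n ]} _ _ = +<+ (s≤s z≤n)
  0<i*j⇒0<j {+[1+ m ]} {+0} _ p rewrite ℕ.*-zeroʳ m = contradiction p λ { (+<+ ()) }
  0<i*j⇒0<j {+0} (+<+ ())

  0<-⇒< : ∀ {i j} → 0ℤ < j - i → i < j
  0<-⇒< {i} {j} p = subst₂ _<_ (+-identityˡ i) (solve 2 (λ i j → j :- i :+ i := j) refl i j) (+-monoˡ-< i p)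

  <⇒0<- : ∀ {i j} → i < j → 0ℤ < j - i
  <⇒0<- {i} {j} p = subst (_< j - i) (+-inverseʳ i) (+-monoˡ-< (- i) p)

  -- The minimum of a three-term recurrence up to the middle index.

  module Gap (n : ℕ) (M : ℤ) (X : ℕ → ℤ)
             (2≤M : + 2 ≤ M) (M<N : M < + n) (0<X₀ : 0ℤ < X 0)
             (rec₀ : + n * X 1 ≡ - M * X 0)
             (rec : ∀ w → suc w ℕ.< n →
                    (+ n - + suc w) * X (2 ℕ.+ w) + + suc w * X w ≡ - M * X (suc w))
             where

    private
      N = + n
      Q = N * N - M * M

    0<M : 0ℤ < M
    0<M = <-≤-trans (+<+ (s≤s z≤n)) 2≤M

    0<N : 0ℤ < N
    0<N = <-trans 0<M M<N

    0<Q : 0ℤ < Q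
    0<Q = subst (0ℤ <_) (solve 2 (λ n m → (n :- m) :* (n :+ m) := n :* n :- m :* m) refl N M)
            (0<i*j (<⇒0<- M<N) (+-mono-< 0<N 0<M))

    X₁<0 : 0ℤ < - X 1
    X₁<0 = 0<i*j⇒0<j 0<N (subst (0ℤ <_) eq (0<i*j 0<M 0<X₀))
      where
      eq : M * X 0 ≡ N * - X 1
      eq = begin
        M * X 0        ≡⟨ solve 2 (λ m x → m :* x := :- (:- m :* x)) refl M (X 0) ⟩
        - (- M * X 0)  ≡⟨ cong -_ rec₀ ⟨
        - (N * X 1)    ≡⟨ solve 2 (λ n x → :- (n :* x) := n :* :- x) refl N (X 1) ⟩
        N * - X 1      ∎

    -- An energy of the three-term recurrence: it decreases up to the middle and dominates the
    -- squares X w * X w, by F-mono and QX²≤NF.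
    F : ℕ → ℤ
    F w = N * (X w * X w + X (suc w) * X (suc w)) + + 2 * M * (X w * X (suc w))

    -- The difference factors as `x - z` times a term linear in `- M * y`. The recurrence expresses
    -- `- M * y` through `x` and `z`, and a perfect square remains, with a coefficient that is
    -- nonnegative up to the middle.
    F-step : ∀ w → suc w ℕ.< n →
      F w - F (suc w) ≡ (N - + 2 * + suc w) * ((X (2 ℕ.+ w) - X w) * (X (2 ℕ.+ w) - X w))
    F-step w w<n = begin
      F w - F (suc w)
        ≡⟨ solve 5 (λ n m x y z →
             (n :* (x :* x :+ y :* y) :+ con (+ 2) :* m :* (x :* y)) :- (n :* (y :* y :+ z :* z) :+ con (+ 2) :* m :* (y :* z))
             := (x :- z) :* (n :* (x :+ z) :- con (+ 2) :* (:- m :* y))) refl N M x y z ⟩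
      (x - z) * (N * (x + z) - + 2 * (- M * y))
        ≡⟨ cong (λ v → (x - z) * (N * (x + z) - + 2 * v)) (rec w w<n) ⟨
      (x - z) * (N * (x + z) - + 2 * ((N - + suc w) * z + + suc w * x))
        ≡⟨ solve 4 (λ n w x z → (x :- z) :* (n :* (x :+ z) :- con (+ 2) :* ((n :- w) :* z :+ w :* x))
             := (n :- con (+ 2) :* w) :* ((z :- x) :* (z :- x))) refl N (+ suc w) x z ⟩
      (N - + 2 * + suc w) * ((z - x) * (z - x)) ∎
      where
      x = X w
      y = X (suc w)
      z = X (2 ℕ.+ w)

    F-mono : ∀ w → 2 ℕ.* suc w ℕ.≤ n → F (suc w) ≤ F w
    F-mono w 2w≤n = 0≤i-j⇒j≤i (subst (0ℤ ≤_) (sym (F-step w w<n))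
        (0≤i*j (i≤j⇒0≤j-i (subst (_≤ N) (pos-* 2 (suc w)) (+≤+ 2w≤n))) (0≤i*i (X (2 ℕ.+ w) - X w))))
      where
      w<n : suc w ℕ.< n
      w<n = ℕ.<-≤-trans (ℕ.m<m+n (suc w) (s≤s z≤n)) 2w≤n

    F≤F₂ : ∀ w → 2 ℕ.* (2 ℕ.+ w) ℕ.≤ n → F (2 ℕ.+ w) ≤ F 2
    F≤F₂ zero    _ = ≤-refl
    F≤F₂ (suc w) h = ≤-trans (F-mono (2 ℕ.+ w) h)
      (F≤F₂ w (ℕ.≤-trans (ℕ.*-monoʳ-≤ 2 (ℕ.n≤1+n (2 ℕ.+ w))) h))

    -- Completing the square: the right side minus the left is the square of
    -- `N * X w + M * X (suc w)`.
    QX²≤NF : ∀ w → Q * (X (suc w) * X (suc w)) ≤ N * F w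
    QX²≤NF w = 0≤i-j⇒j≤i (subst (0ℤ ≤_)
      (solve 4 (λ n m x y → (n :* x :+ m :* y) :* (n :* x :+ m :* y)
          := n :* (n :* (x :* x :+ y :* y) :+ con (+ 2) :* m :* (x :* y)) :- (n :* n :- m :* m) :* (y :* y))
        refl N M (X w) (X (suc w)))
      (0≤i*i (N * X w + M * X (suc w))))

    -- The differences whose squares measure the energy lost from `F 0` to `F 1` and from `F 1` to
    -- `F 2`.
    u v : ℤ
    u = X 2 - X 0
    v = X 3 - X 1

    module _ (1<n : 1 ℕ.< n) where
      u-eq : N * ((N - 1ℤ) * u) ≡ - (Q * X 0)
      u-eq = begin
        N * ((N - 1ℤ) * u)
          ≡⟨ solve 3 (λ n x z → n :* ((n :- con 1ℤ) :* (z :- x)) := n :* ((n :- con 1ℤ) :* z :+ con 1ℤ :* x) :- n :* n :* x) refl N (X 0) (X 2) ⟩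
        N * ((N - 1ℤ) * X 2 + 1ℤ * X 0) - N * N * X 0
          ≡⟨ cong (λ r → N * r - N * N * X 0) (rec 0 1<n) ⟩
        N * (- M * X 1) - N * N * X 0
          ≡⟨ solve 4 (λ n m x y → n :* (:- m :* y) :- n :* n :* x := :- m :* (n :* y) :- n :* n :* x) refl N M (X 0) (X 1) ⟩
        - M * (N * X 1) - N * N * X 0
          ≡⟨ cong (λ r → - M * r - N * N * X 0) rec₀ ⟩
        - M * (- M * X 0) - N * N * X 0
          ≡⟨ solve 3 (λ n m x → :- m :* (:- m :* x) :- n :* n :* x := :- ((n :* n :- m :* m) :* x)) refl N M (X 0) ⟩
        - (Q * X 0) ∎

      0<N-1 : 0ℤ < N - 1ℤ
      0<N-1 = <⇒0<- (+<+ 1<n)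

      0<-u : 0ℤ < - u
      0<-u = 0<i*j⇒0<j 0<N-1 (0<i*j⇒0<j 0<N (subst (0ℤ <_) eq (0<i*j 0<Q 0<X₀)))
        where
        eq : Q * X 0 ≡ N * ((N - 1ℤ) * - u)
        eq = begin
          Q * X 0                   ≡⟨ neg-involutive (Q * X 0) ⟨
          - - (Q * X 0)             ≡⟨ cong -_ u-eq ⟨
          - (N * ((N - 1ℤ) * u))    ≡⟨ solve 3 (λ n p u → :- (n :* (p :* u)) := n :* (p :* :- u)) refl N (N - 1ℤ) u ⟩
          N * ((N - 1ℤ) * - u)      ∎

      -- The energy argument starts only at `X 3`, so this difference is computed explicitly from
      -- the first two recurrences; it is positive because `M` exceeds 1.
      X₁<X₂ : X 1 < X 2
      X₁<X₂ = 0<-⇒< (0<i*j⇒0<j 0<N (0<i*j⇒0<j 0<N-1 (subst (0ℤ <_) (sym eq)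
                (0<i*j (0<i*j (<⇒0<- (<-≤-trans (+<+ (s≤s (s≤s z≤n))) 2≤M)) (+-mono-< 0<N 0<M)) 0<X₀))))
        where
        eq : (N - 1ℤ) * (N * (X 2 - X 1)) ≡ (M - 1ℤ) * (N + M) * X 0
        eq = begin
          (N - 1ℤ) * (N * (X 2 - X 1))
            ≡⟨ solve 4 (λ n x y z → (n :- con 1ℤ) :* (n :* (z :- y)) := n :* ((n :- con 1ℤ) :* (z :- x)) :+ (n :- con 1ℤ) :* (n :* x :- n :* y)) refl N (X 0) (X 1) (X 2) ⟩
          N * ((N - 1ℤ) * u) + (N - 1ℤ) * (N * X 0 - N * X 1)
            ≡⟨ cong₂ (λ r s → r + (N - 1ℤ) * (N * X 0 - s)) u-eq rec₀ ⟩
          - (Q * X 0) + (N - 1ℤ) * (N * X 0 - - M * X 0)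
            ≡⟨ solve 3 (λ n m x → :- ((n :* n :- m :* m) :* x) :+ (n :- con 1ℤ) :* (n :* x :- :- m :* x) := (m :- con 1ℤ) :* (n :+ m) :* x) refl N M (X 0) ⟩
          (M - 1ℤ) * (N + M) * X 0 ∎

    module _ (5≤n : 5 ℕ.≤ n) where
      private
        1<n : 1 ℕ.< n
        1<n = ℕ.≤-trans (s≤s (s≤s z≤n)) 5≤n
        2<n : 2 ℕ.< n
        2<n = ℕ.≤-trans (s≤s (s≤s (s≤s z≤n))) 5≤n

      v-eq : (N - + 2) * v ≡ - M * u
      v-eq = begin
        (N - + 2) * v
          ≡⟨ solve 3 (λ n x y → (n :- con (+ 2)) :* (y :- x) := (n :- con (+ 2)) :* y :+ con (+ 2) :* x :- n :* x) refl N (X 1) (X 3) ⟩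
        (N - + 2) * X 3 + + 2 * X 1 - N * X 1
          ≡⟨ cong₂ _-_ (rec 1 2<n) rec₀ ⟩
        - M * X 2 - - M * X 0
          ≡⟨ solve 3 (λ m x z → :- m :* z :- :- m :* x := :- m :* (z :- x)) refl M (X 0) (X 2) ⟩
        - M * u ∎

      -- N * F 1 slightly exceeds Q * (X 1 * X 1), so the energy bound must start from F 2.
      T : ℤ
      T = Q * (X 1 * X 1) - N * F 2

      F₂-eq : F 2 ≡ F 0 - (N - + 2) * (u * u) - (N - + 4) * (v * v)
      F₂-eq = begin
        F 2
          ≡⟨ solve 3 (λ a b c → c := a :- (a :- b) :- (b :- c)) refl (F 0) (F 1) (F 2) ⟩
        F 0 - (F 0 - F 1) - (F 1 - F 2)
          ≡⟨ cong₂ (λ r s → F 0 - r - s) (F-step 0 1<n) (F-step 1 2<n) ⟩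
        F 0 - (N - + 2) * (u * u) - (N - + 4) * (v * v) ∎

      N²F₀ : N * (N * F 0) ≡ N * (Q * (X 0 * X 0))
      N²F₀ = cong (N *_) (begin
        N * F 0
          ≡⟨ solve 4 (λ n m x y → n :* (n :* (x :* x :+ y :* y) :+ con (+ 2) :* m :* (x :* y))
               := n :* n :* (x :* x) :+ n :* y :* (n :* y) :+ con (+ 2) :* m :* x :* (n :* y)) refl N M (X 0) (X 1) ⟩
        N * N * (X 0 * X 0) + N * X 1 * (N * X 1) + + 2 * M * X 0 * (N * X 1)
          ≡⟨ cong (λ r → N * N * (X 0 * X 0) + r * r + + 2 * M * X 0 * r) rec₀ ⟩
        N * N * (X 0 * X 0) + - M * X 0 * (- M * X 0) + + 2 * M * X 0 * (- M * X 0)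
          ≡⟨ solve 3 (λ n m x → n :* n :* (x :* x) :+ :- m :* x :* (:- m :* x) :+ con (+ 2) :* m :* x :* (:- m :* x)
               := (n :* n :- m :* m) :* (x :* x)) refl N M (X 0) ⟩
        Q * (X 0 * X 0) ∎)

      -- The factor `N * N` lets `rec₀` replace `N * X 1`. The terms in `X 0` then collapse to minus
      -- the square of `Q * X 0`, which `u-eq` expresses through `u`; since
      -- `N (N - 2) - (N - 1)² = -1`, only `- u * u` survives beside the term in `v`.
      N²T : N * (N * T) ≡ N * (N * (N * (N - + 4) * (v * v) - u * u))
      N²T = begin
        N * (N * T)
          ≡⟨ cong (λ r → N * (N * (Q * (X 1 * X 1) - N * r))) F₂-eq ⟩
        N * (N * (Q * (X 1 * X 1) - N * (F 0 - (N - + 2) * (u * u) - (N - + 4) * (v * v))))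
          ≡⟨ solve 6 (λ n q y f u v →
               n :* (n :* (q :* (y :* y) :- n :* (f :- (n :- con (+ 2)) :* u :- (n :- con (+ 4)) :* v)))
               := q :* ((n :* y) :* (n :* y)) :- n :* (n :* (n :* f)) :+ n :* (n :* (n :* ((n :- con (+ 2)) :* u :+ (n :- con (+ 4)) :* v))))
               refl N Q (X 1) (F 0) (u * u) (v * v) ⟩
        Q * ((N * X 1) * (N * X 1)) - N * (N * (N * F 0)) + N * (N * (N * ((N - + 2) * (u * u) + (N - + 4) * (v * v))))
          ≡⟨ cong₂ (λ r s → Q * (r * r) - N * s + N * (N * (N * ((N - + 2) * (u * u) + (N - + 4) * (v * v))))) rec₀ N²F₀ ⟩
        Q * ((- M * X 0) * (- M * X 0)) - N * (N * (Q * (X 0 * X 0))) + N * (N * (N * ((N - + 2) * (u * u) + (N - + 4) * (v * v))))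
          ≡⟨ solve 5 (λ n m x u v →
               (n :* n :- m :* m) :* ((:- m :* x) :* (:- m :* x)) :- n :* (n :* ((n :* n :- m :* m) :* (x :* x))) :+ n :* (n :* (n :* ((n :- con (+ 2)) :* u :+ (n :- con (+ 4)) :* v)))
               := :- ((:- ((n :* n :- m :* m) :* x)) :* (:- ((n :* n :- m :* m) :* x))) :+ n :* (n :* (n :* ((n :- con (+ 2)) :* u :+ (n :- con (+ 4)) :* v))))
               refl N M (X 0) (u * u) (v * v) ⟩
        - (- (Q * X 0) * - (Q * X 0)) + N * (N * (N * ((N - + 2) * (u * u) + (N - + 4) * (v * v))))
          ≡⟨ cong (λ r → - (r * r) + N * (N * (N * ((N - + 2) * (u * u) + (N - + 4) * (v * v))))) (u-eq 1<n) ⟨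
        - (N * ((N - 1ℤ) * u) * (N * ((N - 1ℤ) * u))) + N * (N * (N * ((N - + 2) * (u * u) + (N - + 4) * (v * v))))
          ≡⟨ solve 3 (λ n u v →
               :- (n :* ((n :- con 1ℤ) :* u) :* (n :* ((n :- con 1ℤ) :* u))) :+ n :* (n :* (n :* ((n :- con (+ 2)) :* (u :* u) :+ (n :- con (+ 4)) :* v)))
               := n :* (n :* (n :* (n :- con (+ 4)) :* v :- u :* u))) refl N u (v * v) ⟩
        N * (N * (N * (N - + 4) * (v * v) - u * u)) ∎

      -- Up to positive factors, the coefficient of `u * u` in `T` once `v-eq` has eliminated `v`.
      P : ℤ
      P = N * (N - + 4) * (M * M) - (N - + 2) * (N - + 2)

      T-eq : (N - + 2) * (N - + 2) * (N * (N * T)) ≡ N * (N * (P * (u * u)))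
      T-eq = begin
        (N - + 2) * (N - + 2) * (N * (N * T))
          ≡⟨ cong ((N - + 2) * (N - + 2) *_) N²T ⟩
        (N - + 2) * (N - + 2) * (N * (N * (N * (N - + 4) * (v * v) - u * u)))
          ≡⟨ solve 3 (λ n u v → (n :- con (+ 2)) :* (n :- con (+ 2)) :* (n :* (n :* (n :* (n :- con (+ 4)) :* (v :* v) :- u)))
               := n :* (n :* (n :* (n :- con (+ 4)) :* ((n :- con (+ 2)) :* v :* ((n :- con (+ 2)) :* v)) :- (n :- con (+ 2)) :* (n :- con (+ 2)) :* u))) refl N (u * u) v ⟩
        N * (N * (N * (N - + 4) * ((N - + 2) * v * ((N - + 2) * v)) - (N - + 2) * (N - + 2) * (u * u)))
          ≡⟨ cong (λ r → N * (N * (N * (N - + 4) * (r * r) - (N - + 2) * (N - + 2) * (u * u)))) v-eq ⟩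
        N * (N * (N * (N - + 4) * (- M * u * (- M * u)) - (N - + 2) * (N - + 2) * (u * u)))
          ≡⟨ solve 3 (λ n m u → n :* (n :* (n :* (n :- con (+ 4)) :* (:- m :* u :* (:- m :* u)) :- (n :- con (+ 2)) :* (n :- con (+ 2)) :* (u :* u)))
               := n :* (n :* ((n :* (n :- con (+ 4)) :* (m :* m) :- (n :- con (+ 2)) :* (n :- con (+ 2))) :* (u :* u)))) refl N M u ⟩
        N * (N * (P * (u * u))) ∎

      -- `P` is its value at `M = 2`, namely `3 N² - 12 N - 4`, plus a nonnegative multiple of
      -- `M² - 4`. Expanded about `N = 5`, that value has only positive coefficients.
      0<P : 0ℤ < P
      0<P = subst (0ℤ <_)
        (solve 2 (λ n m → n :* (n :- con (+ 4)) :* ((m :- con (+ 2)) :* (m :+ con (+ 2)))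
                          :+ (con (+ 3) :* ((n :- con (+ 5)) :* (n :- con (+ 5))) :+ con (+ 18) :* (n :- con (+ 5)) :+ con (+ 11))
            := n :* (n :- con (+ 4)) :* (m :* m) :- (n :- con (+ 2)) :* (n :- con (+ 2))) refl N M)
        (+-mono-≤-<
          (0≤i*j (0≤i*j (<⇒≤ 0<N) (i≤j⇒0≤j-i (+≤+ (ℕ.≤-trans (ℕ.n≤1+n 4) 5≤n))))
                 (0≤i*j (i≤j⇒0≤j-i 2≤M) (<⇒≤ (+-mono-<-≤ 0<M (+≤+ z≤n)))))
          (+-mono-≤-< (+-mono-≤ (0≤i*j {+ 3} (+≤+ z≤n) (0≤i*i (N - + 5)))
                                (0≤i*j {+ 18} (+≤+ z≤n) (i≤j⇒0≤j-i (+≤+ 5≤n))))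
                      (+<+ (s≤s z≤n))))

      0<T : 0ℤ < T
      0<T = 0<i*j⇒0<j 0<N (0<i*j⇒0<j 0<N (0<i*j⇒0<j (0<i*j 0<N-2 0<N-2)
              (subst (0ℤ <_) (sym T-eq) (0<i*j 0<N (0<i*j 0<N (0<i*j 0<P 0<u²))))))
        where
        0<N-2 : 0ℤ < N - + 2
        0<N-2 = <⇒0<- (+<+ 2<n)
        0<u² : 0ℤ < u * u
        0<u² = subst (0ℤ <_) (solve 1 (λ u → :- u :* :- u := u :* u) refl u) (0<i*j (0<-u 1<n) (0<-u 1<n))

      -- If `x` were at most the negative number `X 1`, its square would be at least that of `X 1`;
      -- but the energy gives `Q * (x * x) ≤ N * F 2 < Q * (X 1 * X 1)`.
      X₁<X₃₊ : ∀ w → 2 ℕ.* (2 ℕ.+ w) ℕ.≤ n → X 1 < X (3 ℕ.+ w)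
      X₁<X₃₊ w 2w≤n = ≰⇒> λ x≤X₁ → <⇒≱ (0<i*j⇒0<j 0<Q 0<QΔ) (i≤j⇒i-j≤0 (square x≤X₁))
        where
        x = X (3 ℕ.+ w)
        QX²≤NF₂ : Q * (x * x) ≤ N * F 2
        QX²≤NF₂ = ≤-trans (QX²≤NF (2 ℕ.+ w)) (*-monoˡ-≤-nonNeg N (F≤F₂ w 2w≤n))
        0<QΔ : 0ℤ < Q * (X 1 * X 1 - x * x)
        0<QΔ = subst (0ℤ <_)
          (solve 4 (λ q a b f → (q :* a :- f) :+ (f :- q :* b) := q :* (a :- b)) refl Q (X 1 * X 1) (x * x) (N * F 2))
          (+-mono-<-≤ 0<T (i≤j⇒0≤j-i QX²≤NF₂))
        square : x ≤ X 1 → X 1 * X 1 ≤ x * x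
        square x≤X₁ = 0≤i-j⇒j≤i (subst (0ℤ ≤_)
          (solve 2 (λ x y → (y :- x) :* (:- y :+ ((y :- x) :+ :- y)) := x :* x :- y :* y) refl x (X 1))
          (0≤i*j (i≤j⇒0≤j-i x≤X₁) (<⇒≤ (+-mono-< X₁<0 (+-mono-≤-< (i≤j⇒0≤j-i x≤X₁) X₁<0)))))

    X₁<X : ∀ w → 2 ℕ.* w ℕ.≤ n → w ≢ 1 → X 1 < X w
    X₁<X 0 _ _ = <-trans (subst (_< 0ℤ) (neg-involutive (X 1)) (neg-mono-< X₁<0)) 0<X₀
    X₁<X 1 _ w≢1 = contradiction refl w≢1
    X₁<X 2 4≤n _ = X₁<X₂ (ℕ.≤-trans (s≤s (s≤s z≤n)) 4≤n)
    -- An index of at least 3 in the first half forces `6 ≤ n`, hence the bound `5 ≤ n`.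
    X₁<X (suc (suc (suc w))) 2w≤n _ = X₁<X₃₊ (ℕ.≤-trans (ℕ.≤-trans (ℕ.n≤1+n 5) (ℕ.*-monoʳ-≤ 2 (s≤s (s≤s (s≤s (z≤n {w})))))) 2w≤n)
      w (ℕ.≤-trans (ℕ.*-monoʳ-≤ 2 (ℕ.n≤1+n (2 ℕ.+ w))) 2w≤n)

  -- The eigenvalue gap for Krawtchouk numbers of even degree.

  module KrawtchoukGap (n j : ℕ) (n+2≤2k : n ℕ.+ 2 ℕ.≤ 2 ℕ.* (j ℕ.+ j)) (k<n : j ℕ.+ j ℕ.< n) where

    private
      k = j ℕ.+ j
      N = + n

    -- Minus the factor in `K-recurrence` when `a + b = n`; `M / n` will be the bound `ρ` for edges.
    M : ℤ
    M = + 2 * + k - N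

    X : ℕ → ℤ
    X w = K (n ℕ.∸ w) w k

    2≤M : + 2 ≤ M
    2≤M = 0≤i-j⇒j≤i (subst (0ℤ ≤_)
      (trans (cong₂ _-_ (pos-* 2 k) (pos-+ n 2)) (solve 2 (λ n k → k :- (n :+ con (+ 2)) := k :- n :- con (+ 2)) refl N (+ 2 * + k)))
      (i≤j⇒0≤j-i (+≤+ n+2≤2k)))

    M<N : M < N
    M<N = 0<-⇒< (subst (0ℤ <_) (solve 2 (λ n k → con (+ 2) :* (n :- k) := n :- (con (+ 2) :* k :- n)) refl N (+ k))
      (0<i*j {+ 2} (+<+ (s≤s z≤n)) (<⇒0<- (+<+ k<n))))

    0<X₀ : 0ℤ < X 0
    0<X₀ = 0<K (ℕ.<⇒≤ k<n)

    rec₀ : N * X 1 ≡ - M * X 0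
    rec₀ = begin
      N * K (n ℕ.∸ 1) 1 k
        ≡⟨ cong (λ a → N * K a 1 k) (ℕ.pred[m∸n]≡m∸[1+n] n 0) ⟨
      N * K (pred n) 1 k
        ≡⟨ +-identityʳ _ ⟨
      N * K (pred n) 1 k + 0ℤ * K (ℕ.suc n) 0 k
        ≡⟨ K-recurrence n 0 k ⟩
      (N + 0ℤ - + 2 * + k) * X 0
        ≡⟨ cong (_* X 0) (solve 2 (λ n k → n :+ con 0ℤ :- con (+ 2) :* k := :- (con (+ 2) :* k :- n)) refl N (+ k)) ⟩
      - M * X 0 ∎

    rec : ∀ w → suc w ℕ.< n → (N - + suc w) * X (2 ℕ.+ w) + + suc w * X w ≡ - M * X (suc w)
    rec w w<n = begin
      (N - + suc w) * X (2 ℕ.+ w) + + suc w * X w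
        ≡⟨ cong₂ _+_ (cong₂ (λ c d → c * K d (2 ℕ.+ w) k) (sym a≡) (sym (ℕ.pred[m∸n]≡m∸[1+n] n (suc w))))
                     (cong (λ d → + suc w * K d w k) (ℕ.+-∸-assoc 1 (ℕ.<⇒≤ w<n))) ⟩
      + a * K (pred a) (2 ℕ.+ w) k + + suc w * K (suc a) w k
        ≡⟨ K-recurrence a (suc w) k ⟩
      (+ a + + suc w - + 2 * + k) * X (suc w)
        ≡⟨ cong (λ c → (c + + suc w - + 2 * + k) * X (suc w)) a≡ ⟩
      (N - + suc w + + suc w - + 2 * + k) * X (suc w)
        ≡⟨ cong (_* X (suc w)) (solve 3 (λ n w k → n :- w :+ w :- con (+ 2) :* k := :- (con (+ 2) :* k :- n)) refl N (+ suc w) (+ k)) ⟩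
      - M * X (suc w) ∎
      where
      a = n ℕ.∸ suc w
      a≡ : + a ≡ N - + suc w
      a≡ = trans (sym (⊖-≥ (ℕ.<⇒≤ w<n))) (sym (m-n≡m⊖n n (suc w)))

    open Gap n M X 2≤M M<N 0<X₀ rec₀ rec using (X₁<X)

    X₁ : ℤ
    X₁ = X 1

    -- `X₁<X` reaches only the half `b ≤ a`; the other half follows by `K-swap`, which is how
    -- `a = 1` joins `b = 1` as an exception.
    gap : ∀ a b → a ℕ.+ b ≡ n → a ≢ 1 → b ≢ 1 → X₁ < K a b k
    gap a b refl a≢1 b≢1 with ℕ.≤-total b a
    ... | inj₁ b≤a = subst (X₁ <_) (cong (λ c → K c b k) (ℕ.m+n∸n≡m a b))
          (X₁<X b (ℕ.≤-trans (ℕ.+-monoˡ-≤ (b ℕ.+ 0) b≤a) (ℕ.≤-reflexive (cong (a ℕ.+_) (ℕ.+-identityʳ b)))) b≢1)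
    ... | inj₂ a≤b = subst (X₁ <_) (trans (cong (λ c → K c a k) (ℕ.m+n∸m≡n a b)) (K-swap b a j))
          (X₁<X a (ℕ.+-monoʳ-≤ a (ℕ.≤-trans (ℕ.≤-reflexive (ℕ.+-identityʳ a)) a≤b)) a≢1)

    K₁≡X₁ : ∀ a → a ℕ.+ 1 ≡ n → K a 1 k ≡ X₁
    K₁≡X₁ a refl = cong (λ c → K c 1 k) (sym (ℕ.m+n∸n≡m a 1))

    ¹K≡X₁ : ∀ b → 1 ℕ.+ b ≡ n → K 1 b k ≡ X₁
    ¹K≡X₁ b refl = K-swap 1 b j

open Krawtchouk using (K; K-zero; K-suc₂; <⇒0<-; module KrawtchoukGap)


-- The integers inside the real field.

module RealFieldProperties {c ℓ₁ ℓ₂} (ℝ : RealField c ℓ₁ ℓ₂) where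
  open RealField ℝ
  open CommutativeRing commutativeRing public using (refl; sym; trans; reflexive)
  open RingProperties (CommutativeRing.ring commutativeRing) public
    using (-‿distribˡ-*; -‿distribʳ-*; -0#≈0#; -‿involutive)
  open AbelianGroupProperties (CommutativeRing.+-abelianGroup commutativeRing) public
    using (⁻¹-∙-comm)
  open SemiringMult semiring using (×-homo-+; ×1-homo-*)
  open SetoidReasoning setoid

  ι : ℤ → Carrier
  ι (+ n)    = n · 1#
  ι -[1+ n ] = - (suc n · 1#)

  ι-⊖ : ∀ m n → ι (m ℤ.⊖ n) ≈ m · 1# - n · 1#
  ι-⊖ zero    zero    = sym (-‿inverseʳ 0#)
  ι-⊖ zero    (suc n) = sym (+-identityˡ _)
  ι-⊖ (suc m) zero    = sym (trans (+-congˡ -0#≈0#) (+-identityʳ _))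
  ι-⊖ (suc m) (suc n) = begin
    ι (suc m ℤ.⊖ suc n)                  ≡⟨ ≡.cong ι (ℤ.[1+m]⊖[1+n]≡m⊖n m n) ⟩
    ι (m ℤ.⊖ n)                          ≈⟨ ι-⊖ m n ⟩
    x - y                                ≈⟨ +-congʳ (+-identityʳ x) ⟨
    x + 0# - y                           ≈⟨ +-congʳ (+-congˡ (-‿inverseʳ 1#)) ⟨
    x + (1# - 1#) - y                    ≈⟨ +-congʳ (+-assoc x 1# (- 1#)) ⟨
    x + 1# - 1# - y                      ≈⟨ +-assoc _ _ _ ⟩
    x + 1# + (- 1# - y)                  ≈⟨ +-cong (+-comm x 1#) (⁻¹-∙-comm 1# y) ⟩
    1# + x - (1# + y)                    ∎
    where
    x = m · 1#
    y = n · 1#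

  ι-neg : ∀ i → ι (ℤ.- i) ≈ - ι i
  ι-neg (+ zero)  = sym -0#≈0#
  ι-neg (+ suc n) = refl
  ι-neg -[1+ n ]  = sym (-‿involutive _)

  ι-+ : ∀ i j → ι (i ℤ.+ j) ≈ ι i + ι j
  ι-+ (+ m)    (+ n)    = ×-homo-+ 1# m n
  ι-+ (+ m)    -[1+ n ] = ι-⊖ m (suc n)
  ι-+ -[1+ m ] (+ n)    = trans (ι-⊖ n (suc m)) (+-comm _ _)
  ι-+ -[1+ m ] -[1+ n ] = begin
    - (suc (suc (m ℕ.+ n)) · 1#)       ≡⟨ ≡.cong (λ k → - (suc k · 1#)) (ℕ.+-suc m n) ⟨
    - ((suc m ℕ.+ suc n) · 1#)         ≈⟨ -‿cong (×-homo-+ 1# (suc m) (suc n)) ⟩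
    - (suc m · 1# + suc n · 1#)        ≈⟨ ⁻¹-∙-comm _ _ ⟨
    - (suc m · 1#) - (suc n · 1#)      ∎

  ι-*-+ : ∀ m j → ι (+ m ℤ.* j) ≈ ι (+ m) * ι j
  ι-*-+ m (+ n)    = begin
    ι (+ m ℤ.* + n)      ≡⟨ ≡.cong ι (ℤ.pos-* m n) ⟨
    (m ℕ.* n) · 1#       ≈⟨ ×1-homo-* m n ⟩
    m · 1# * (n · 1#)    ∎
  ι-*-+ m -[1+ n ] = begin
    ι (+ m ℤ.* (ℤ.- + suc n))    ≡⟨ ≡.cong ι (ℤ.neg-distribʳ-* (+ m) (+ suc n)) ⟨
    ι (ℤ.- (+ m ℤ.* + suc n))    ≈⟨ ι-neg (+ m ℤ.* + suc n) ⟩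
    - ι (+ m ℤ.* + suc n)        ≈⟨ -‿cong (ι-*-+ m (+ suc n)) ⟩
    - (ι (+ m) * ι (+ suc n))    ≈⟨ -‿distribʳ-* _ _ ⟩
    ι (+ m) * - ι (+ suc n)      ∎

  ι-* : ∀ i j → ι (i ℤ.* j) ≈ ι i * ι j
  ι-* (+ m)    j = ι-*-+ m j
  ι-* -[1+ m ] j = begin
    ι ((ℤ.- + suc m) ℤ.* j)      ≡⟨ ≡.cong ι (ℤ.neg-distribˡ-* (+ suc m) j) ⟨
    ι (ℤ.- (+ suc m ℤ.* j))      ≈⟨ ι-neg (+ suc m ℤ.* j) ⟩
    - ι (+ suc m ℤ.* j)          ≈⟨ -‿cong (ι-*-+ (suc m) j) ⟩
    - (ι (+ suc m) * ι j)        ≈⟨ -‿distribˡ-* _ _ ⟩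
    - ι (+ suc m) * ι j          ∎

  ι-1 : ι 1ℤ ≈ 1#
  ι-1 = +-identityʳ 1#

  -- Gives the ring solver integer coefficients, whose equality is decidable, unlike equality in the
  -- field.
  ι-hom : ℤ.+-*-rawRing -Raw-AlmostCommutative⟶ fromCommutativeRing commutativeRing
  ι-hom = record
    { ⟦_⟧    = ι
    ; +-homo = ι-+
    ; *-homo = ι-*
    ; -‿homo = ι-neg
    ; 0-homo = refl
    ; 1-homo = ι-1
    }

  open RingSolver ℤ.+-*-rawRing (fromCommutativeRing commutativeRing) ι-hom
    (λ i j → map (λ eq → reflexive (≡.cong ι eq)) (dec⇒maybe (i ℤ.≟ j))) public
    using (solve; _:=_; _:+_; _:*_; _:-_; :-_; con)

  -- Constructive order lemmas.

  ≤-reflexive : ∀ {x y} → x ≈ y → x ≤ y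
  ≤-reflexive x≈y y<x = <-irrefl (sym x≈y) y<x

  ≤-refl : ∀ {x} → x ≤ x
  ≤-refl = ≤-reflexive refl

  -- As `≤` is a negated `<`, the proof refutes a strict inequality by splitting it at `y` with
  -- cotransitivity.
  ≤-trans : ∀ {x y z} → x ≤ y → y ≤ z → x ≤ z
  ≤-trans {y = y} x≤y y≤z z<x = [ y≤z , x≤y ] (<-cotrans z<x y)

  ≤-respˡ-≈ : ∀ {x y z} → x ≈ y → x ≤ z → y ≤ z
  ≤-respˡ-≈ x≈y x≤z z<y = x≤z (<-respʳ-≈ (sym x≈y) z<y)

  ≤-respʳ-≈ : ∀ {x y z} → x ≈ y → z ≤ x → z ≤ y
  ≤-respʳ-≈ x≈y z≤x y<z = z≤x (<-respˡ-≈ (sym x≈y) y<z)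

  <⇒≤ : ∀ {x y} → x < y → x ≤ y
  <⇒≤ = <-asym

  <-≤-trans : ∀ {x y z} → x < y → y ≤ z → x < z
  <-≤-trans {z = z} x<y y≤z = [ (λ x<z → x<z) , (λ z<y → contradiction z<y y≤z) ] (<-cotrans x<y z)

  ≤-antisym : ∀ {x y} → x ≤ y → y ≤ x → x ≈ y
  ≤-antisym {x} {y} x≤y y≤x = proj₁ (tight x y) [ y≤x , x≤y ]

  +-cancelʳ-< : ∀ {x y} z → x + z < y + z → x < y
  +-cancelʳ-< {x} {y} z h = <-respˡ-≈ (eq x z) (<-respʳ-≈ (eq y z) (+-monoˡ-< (- z) h))
    where
    eq : ∀ x z → x + z - z ≈ x
    eq = solve 2 (λ x z → x :+ z :- z := x) refl

  +-mono-≤ : ∀ {x y u v} → x ≤ y → u ≤ v → x + u ≤ y + v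
  +-mono-≤ {x} {y} {u} {v} x≤y u≤v h = [ right , left ] (<-cotrans h (y + u))
    where
    right : ¬ y + v < y + u
    right h = u≤v (+-cancelʳ-< y (<-respˡ-≈ (+-comm y v) (<-respʳ-≈ (+-comm y u) h)))
    left : ¬ y + u < x + u
    left h = x≤y (+-cancelʳ-< u h)

  x<y⇒0<y-x : ∀ {x y} → x < y → 0# < y - x
  x<y⇒0<y-x {x} h = <-respˡ-≈ (-‿inverseʳ x) (+-monoˡ-< (- x) h)

  0<y-x⇒x<y : ∀ {x y} → 0# < y - x → x < y
  0<y-x⇒x<y {x} {y} h = +-cancelʳ-< (- x) (<-respˡ-≈ (sym (-‿inverseʳ x)) h)

  x≤y⇒0≤y-x : ∀ {x y} → x ≤ y → 0# ≤ y - x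
  x≤y⇒0≤y-x {x} {y} x≤y = ≤-respˡ-≈ (-‿inverseʳ x) (+-mono-≤ x≤y (≤-refl { - x}))

  x-y≤0⇒x≤y : ∀ {x y} → x - y ≤ 0# → x ≤ y
  x-y≤0⇒x≤y {x} {y} h = ≤-respˡ-≈ (solve 2 (λ x y → x :- y :+ y := x) refl x y)
    (≤-respʳ-≈ (+-identityˡ y) (+-mono-≤ h (≤-refl {y})))

  x≤y⇒x-y≤0 : ∀ {x y} → x ≤ y → x - y ≤ 0#
  x≤y⇒x-y≤0 {x} {y} x≤y = ≤-respʳ-≈ (-‿inverseʳ y) (+-mono-≤ x≤y (≤-refl { - y}))

  neg-pos : ∀ {x} → x < 0# → 0# < - x
  neg-pos {x} x<0 = <-respʳ-≈ (+-identityˡ (- x)) (x<y⇒0<y-x x<0)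

  -- The signs cannot be decided. If `x * y < 0`, a positive `x` would force `y` to be zero; so `x`
  -- is itself zero, and the product vanishes.
  0≤x*y : ∀ {x y} → 0# ≤ x → 0# ≤ y → 0# ≤ x * y
  0≤x*y {x} {y} 0≤x 0≤y xy<0 = <-irrefl (trans (*-congʳ (≤-antisym x≤0 0≤x)) (zeroˡ y)) xy<0
    where
    x≤0 : x ≤ 0#
    x≤0 0<x = <-irrefl (trans (*-congˡ (≤-antisym (λ 0<y → <-asym xy<0 (*-pos 0<x 0<y)) 0≤y)) (zeroʳ x)) xy<0

  x*x>0 : ∀ {x} → x # 0# → 0# < x * x
  x*x>0 {x} (inj₁ x<0) = <-respʳ-≈ (solve 1 (λ x → :- x :* :- x := x :* x) refl x) (*-pos (neg-pos x<0) (neg-pos x<0))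
  x*x>0 {x} (inj₂ 0<x) = *-pos 0<x 0<x

  0≤x*x : ∀ x → 0# ≤ x * x
  0≤x*x x xx<0 = <-irrefl (trans (*-congʳ x≈0) (zeroˡ x)) xx<0
    where
    x≈0 : x ≈ 0#
    x≈0 = proj₁ (tight x 0#) λ x#0 → <-asym xx<0 (x*x>0 x#0)

  x*x≈0⇒x≈0 : ∀ {x} → x * x ≈ 0# → x ≈ 0#
  x*x≈0⇒x≈0 {x} eq = proj₁ (tight x 0#) λ x#0 → <-irrefl (sym eq) (x*x>0 x#0)

  0<x⇒inverse : ∀ x → 0# < x → Carrier
  0<x⇒inverse x 0<x = proj₁ (#⇒invertible {x} {0#} (inj₂ 0<x))

  0<x⇒inverseʳ : ∀ x (0<x : 0# < x) → x * 0<x⇒inverse x 0<x ≈ 1#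
  0<x⇒inverseʳ x 0<x = trans (*-congʳ (sym (trans (+-congˡ -0#≈0#) (+-identityʳ x))))
    (proj₂ (proj₂ (#⇒invertible {x} {0#} (inj₂ 0<x))))

  *-cancelˡ-0< : ∀ {x y z} → 0# < x → x * y ≈ x * z → y ≈ z
  *-cancelˡ-0< {x} {y} {z} 0<x eq = begin
    y              ≈⟨ lem y ⟨
    x⁻¹ * (x * y)  ≈⟨ *-congˡ eq ⟩
    x⁻¹ * (x * z)  ≈⟨ lem z ⟩
    z              ∎
    where
    x⁻¹ = 0<x⇒inverse x 0<x
    lem : ∀ y → x⁻¹ * (x * y) ≈ y
    lem y = begin
      x⁻¹ * (x * y)  ≈⟨ solve 3 (λ i x y → i :* (x :* y) := x :* i :* y) refl x⁻¹ x y ⟩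
      x * x⁻¹ * y    ≈⟨ *-congʳ (0<x⇒inverseʳ x 0<x) ⟩
      1# * y         ≈⟨ *-identityˡ y ⟩
      y              ∎

  0≤inverse : ∀ x (0<x : 0# < x) → 0# ≤ 0<x⇒inverse x 0<x
  0≤inverse x 0<x x⁻¹<0 = <-asym 0<1 (<-respˡ-≈ (0<x⇒inverseʳ x 0<x) (0<y-x⇒x<y
    (<-respʳ-≈ (solve 2 (λ x i → x :* :- i := con 0ℤ :- x :* i) refl x (0<x⇒inverse x 0<x))
      (*-pos 0<x (neg-pos x⁻¹<0)))))

  ι-nonneg : ∀ {i} → 0ℤ ℤ.≤ i → 0# ≤ ι i
  ι-nonneg {+ zero}  _ = ≤-refl
  ι-nonneg {+ suc n} _ = ≤-respˡ-≈ (+-identityˡ 0#) (+-mono-≤ (<⇒≤ 0<1) (ι-nonneg {+ n} (ℤ.+≤+ z≤n)))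

  ι-pos : ∀ {i} → 0ℤ ℤ.< i → 0# < ι i
  ι-pos {+ zero}  (ℤ.+<+ ())
  ι-pos {+ suc n} _ = <-≤-trans 0<1 (≤-respˡ-≈ (+-identityʳ 1#) (+-mono-≤ (≤-refl {1#}) (ι-nonneg {+ n} (ℤ.+≤+ z≤n))))

  0≤x+y : ∀ {x y} → 0# ≤ x → 0# ≤ y → 0# ≤ x + y
  0≤x+y 0≤x 0≤y = ≤-respˡ-≈ (+-identityˡ 0#) (+-mono-≤ 0≤x 0≤y)

  x+y≈0⇒x≈0 : ∀ {x y} → 0# ≤ x → 0# ≤ y → x + y ≈ 0# → x ≈ 0#
  x+y≈0⇒x≈0 {x} {y} 0≤x 0≤y eq = ≤-antisym
    (≤-respˡ-≈ (+-identityʳ x) (≤-respʳ-≈ eq (+-mono-≤ (≤-refl {x}) 0≤y))) 0≤x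

-- Zero counts and parity of binary vectors.

zeros : ∀ {n} → Vec Bool n → ℕ
zeros = count (_≟ᵇ false)

zeros+weight : ∀ {n} (x : Vec Bool n) → zeros x ℕ.+ weight x ≡ n
zeros+weight []          = ≡.refl
zeros+weight (false ∷ x) = ≡.cong suc (zeros+weight x)
zeros+weight (true ∷ x)  = ≡.trans (ℕ.+-suc (zeros x) (weight x)) (≡.cong suc (zeros+weight x))

par : ∀ {m} → Vec Bool m → Bool
par []      = false
par (b ∷ x) = b xor par x

-- The Walsh transform on ℤ₂ᵐ.

module Walsh {c ℓ₁ ℓ₂} (ℝ : RealField c ℓ₁ ℓ₂) where
  open RealField ℝ hiding (zero)
  open RealFieldProperties ℝ
  open SemiringSum semiring using (sum-cong-≋; ∑-distrib-+; *-distribˡ-sum)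
  open SetoidReasoning setoid

  ∑₂ : ∀ {m} → (Vec Bool m → Carrier) → Carrier
  ∑₂ {zero}  f = f []
  ∑₂ {suc m} f = ∑₂ (f ∘ (false ∷_)) + ∑₂ (f ∘ (true ∷_))

  ∑₂-cong : ∀ {m} {f g : Vec Bool m → Carrier} → (∀ x → f x ≈ g x) → ∑₂ f ≈ ∑₂ g
  ∑₂-cong {zero}  h = h []
  ∑₂-cong {suc m} h = +-cong (∑₂-cong (h ∘ (false ∷_))) (∑₂-cong (h ∘ (true ∷_)))

  ∑₂-+ : ∀ {m} (f g : Vec Bool m → Carrier) → ∑₂ (λ x → f x + g x) ≈ ∑₂ f + ∑₂ g
  ∑₂-+ {zero}  f g = refl
  ∑₂-+ {suc m} f g = trans (+-cong (∑₂-+ (f ∘ (false ∷_)) (g ∘ (false ∷_))) (∑₂-+ (f ∘ (true ∷_)) (g ∘ (true ∷_))))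
    (solve 4 (λ a b c d → a :+ b :+ (c :+ d) := a :+ c :+ (b :+ d)) refl _ _ _ _)

  ∑₂-*ˡ : ∀ {m} c (f : Vec Bool m → Carrier) → ∑₂ (λ x → c * f x) ≈ c * ∑₂ f
  ∑₂-*ˡ {zero}  c f = refl
  ∑₂-*ˡ {suc m} c f = trans (+-cong (∑₂-*ˡ c (f ∘ (false ∷_))) (∑₂-*ˡ c (f ∘ (true ∷_)))) (sym (distribˡ c _ _))

  ∑₂-sum : ∀ {m d} (f : Vec Bool m → Vector Carrier d) →
           ∑₂ (λ x → sum (f x)) ≈ sum (λ i → ∑₂ (λ x → f x i))
  ∑₂-sum {zero}  f = refl
  ∑₂-sum {suc m} f = trans (+-cong (∑₂-sum (f ∘ (false ∷_))) (∑₂-sum (f ∘ (true ∷_)))) (sym (∑-distrib-+ (λ i → ∑₂ (λ x → f (false ∷ x) i)) (λ i → ∑₂ (λ x → f (true ∷ x) i))))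

  ∑₂-nonneg : ∀ {m} {f : Vec Bool m → Carrier} → (∀ x → 0# ≤ f x) → 0# ≤ ∑₂ f
  ∑₂-nonneg {zero}  h = h []
  ∑₂-nonneg {suc m} h = 0≤x+y (∑₂-nonneg (h ∘ (false ∷_))) (∑₂-nonneg (h ∘ (true ∷_)))

  ∑₂-nonneg-zero : ∀ {m} {f : Vec Bool m → Carrier} → (∀ x → 0# ≤ f x) → ∑₂ f ≈ 0# → ∀ x → f x ≈ 0#
  ∑₂-nonneg-zero h eq []          = eq
  ∑₂-nonneg-zero h eq (false ∷ x) = ∑₂-nonneg-zero (h ∘ (false ∷_))
    (x+y≈0⇒x≈0 (∑₂-nonneg (h ∘ (false ∷_))) (∑₂-nonneg (h ∘ (true ∷_))) eq) x
  ∑₂-nonneg-zero h eq (true ∷ x)  = ∑₂-nonneg-zero (h ∘ (true ∷_))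
    (x+y≈0⇒x≈0 (∑₂-nonneg (h ∘ (true ∷_))) (∑₂-nonneg (h ∘ (false ∷_))) (trans (+-comm _ _) eq)) x

  -- The values are images under `ι`, so that the ring solver can match them with `con 1ℤ` and
  -- `con -1ℤ`.
  sgn : Bool → Carrier
  sgn false = ι 1ℤ
  sgn true  = ι -1ℤ

  sgn-xor : ∀ b b′ → sgn (b xor b′) ≈ sgn b * sgn b′
  sgn-xor false false = ι-* 1ℤ 1ℤ
  sgn-xor false true  = ι-* 1ℤ -1ℤ
  sgn-xor true  false = ι-* -1ℤ 1ℤ
  sgn-xor true  true  = ι-* -1ℤ -1ℤ

  -- The unnormalised Walsh-Hadamard transform in its fast recursive form, one coordinate at a time,
  -- so that its properties follow by induction on the vector.
  hat : ∀ {m} → (Vec Bool m → Carrier) → Vec Bool m → Carrier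
  hat f []      = f []
  hat f (b ∷ S) = hat (f ∘ (false ∷_)) S + sgn b * hat (f ∘ (true ∷_)) S

  hat-cong : ∀ {m} {f g : Vec Bool m → Carrier} → (∀ x → f x ≈ g x) → ∀ S → hat f S ≈ hat g S
  hat-cong h []      = h []
  hat-cong h (b ∷ S) = +-cong (hat-cong (h ∘ (false ∷_)) S) (*-congˡ (hat-cong (h ∘ (true ∷_)) S))

  hat-+ : ∀ {m} (f g : Vec Bool m → Carrier) S → hat (λ x → f x + g x) S ≈ hat f S + hat g S
  hat-+ f g []      = refl
  hat-+ f g (b ∷ S) = trans (+-cong (hat-+ (f ∘ (false ∷_)) (g ∘ (false ∷_)) S) (*-congˡ (hat-+ (f ∘ (true ∷_)) (g ∘ (true ∷_)) S)))
    (solve 5 (λ a b c d s → a :+ b :+ s :* (c :+ d) := a :+ s :* c :+ (b :+ s :* d)) refl _ _ _ _ _)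

  hat-*ˡ : ∀ {m} c (f : Vec Bool m → Carrier) S → hat (λ x → c * f x) S ≈ c * hat f S
  hat-*ˡ c f []      = refl
  hat-*ˡ c f (b ∷ S) = trans (+-cong (hat-*ˡ c (f ∘ (false ∷_)) S) (*-congˡ (hat-*ˡ c (f ∘ (true ∷_)) S)))
    (solve 4 (λ a c d s → c :* a :+ s :* (c :* d) := c :* (a :+ s :* d)) refl _ _ _ _)

  hat-zero : ∀ {m} {f : Vec Bool m → Carrier} → (∀ x → f x ≈ 0#) → ∀ S → hat f S ≈ 0#
  hat-zero h []      = h []
  hat-zero h (b ∷ S) = trans (+-cong (hat-zero (h ∘ (false ∷_)) S) (*-congˡ (hat-zero (h ∘ (true ∷_)) S)))
    (solve 1 (λ s → con 0ℤ :+ s :* con 0ℤ := con 0ℤ) refl (sgn b))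

  hat-sum : ∀ {m d} (f : Vec Bool m → Vector Carrier d) S →
            hat (λ x → sum (f x)) S ≈ sum (λ i → hat (λ x → f x i) S)
  hat-sum f []      = refl
  hat-sum f (b ∷ S) = trans (+-cong (hat-sum (f ∘ (false ∷_)) S) (trans (*-congˡ (hat-sum (f ∘ (true ∷_)) S)) (*-distribˡ-sum (sgn b) (λ i → hat (λ x → f (true ∷ x) i) S))))
    (sym (∑-distrib-+ (λ i → hat (λ x → f (false ∷ x) i) S) (λ i → sgn b * hat (λ x → f (true ∷ x) i) S)))

  hat-0 : ∀ {m} (f : Vec Bool m → Carrier) → hat f (replicate m false) ≈ ∑₂ f
  hat-0 {zero}  f = refl
  hat-0 {suc m} f = +-cong (hat-0 (f ∘ (false ∷_))) (trans (*-cong ι-1 (hat-0 (f ∘ (true ∷_)))) (*-identityˡ _))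

  2^ : ℕ → Carrier
  2^ zero    = ι 1ℤ
  2^ (suc m) = ι (+ 2) * 2^ m

  0<2^ : ∀ m → 0# < 2^ m
  0<2^ zero    = ι-pos {1ℤ} (ℤ.+<+ (s≤s z≤n))
  0<2^ (suc m) = *-pos (ι-pos {+ 2} (ℤ.+<+ (s≤s z≤n))) (0<2^ m)

  -- Fourier inversion: each coordinate contributes a factor 2, and the cross terms cancel.
  hat-hat : ∀ {m} (f : Vec Bool m → Carrier) x → hat (hat f) x ≈ 2^ m * f x
  hat-hat f [] = trans (sym (*-identityˡ (f []))) (*-congʳ (sym ι-1))
  hat-hat {suc m} f (b ∷ x) = begin
    hat (λ S → hat f₀ S + sgn false * hat f₁ S) x + sgn b * hat (λ S → hat f₀ S + sgn true * hat f₁ S) x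
      ≈⟨ +-cong (split false) (*-congˡ (split true)) ⟩
    2^ m * f₀ x + sgn false * (2^ m * f₁ x) + sgn b * (2^ m * f₀ x + sgn true * (2^ m * f₁ x))
      ≈⟨ case b ⟩
    2^ (suc m) * f (b ∷ x) ∎
    where
    f₀ = f ∘ (false ∷_)
    f₁ = f ∘ (true ∷_)
    split : ∀ s → hat (λ S → hat f₀ S + sgn s * hat f₁ S) x ≈ 2^ m * f₀ x + sgn s * (2^ m * f₁ x)
    split s = trans (hat-+ (hat f₀) (λ S → sgn s * hat f₁ S) x)
      (+-cong (hat-hat f₀ x) (trans (hat-*ˡ (sgn s) (hat f₁) x) (*-congˡ (hat-hat f₁ x))))
    case : ∀ b → 2^ m * f₀ x + sgn false * (2^ m * f₁ x) + sgn b * (2^ m * f₀ x + sgn true * (2^ m * f₁ x)) ≈ 2^ (suc m) * f (b ∷ x)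
    case false = solve 3 (λ p a b → p :* a :+ con 1ℤ :* (p :* b) :+ con 1ℤ :* (p :* a :+ con -1ℤ :* (p :* b)) := con (+ 2) :* p :* a) refl (2^ m) (f₀ x) (f₁ x)
    case true  = solve 3 (λ p a b → p :* a :+ con 1ℤ :* (p :* b) :+ con -1ℤ :* (p :* a :+ con -1ℤ :* (p :* b)) := con (+ 2) :* p :* b) refl (2^ m) (f₀ x) (f₁ x)

  parseval : ∀ {m} (f g : Vec Bool m → Carrier) → ∑₂ (λ S → hat f S * hat g S) ≈ 2^ m * ∑₂ (λ x → f x * g x)
  parseval {zero}  f g = trans (sym (*-identityˡ _)) (*-congʳ (sym ι-1))
  parseval {suc m} f g = begin
    ∑₂ (λ S → (hat f₀ S + sgn false * hat f₁ S) * (hat g₀ S + sgn false * hat g₁ S))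
      + ∑₂ (λ S → (hat f₀ S + sgn true * hat f₁ S) * (hat g₀ S + sgn true * hat g₁ S))
      ≈⟨ ∑₂-+ {m} _ _ ⟨
    ∑₂ (λ S → (hat f₀ S + sgn false * hat f₁ S) * (hat g₀ S + sgn false * hat g₁ S)
            + (hat f₀ S + sgn true * hat f₁ S) * (hat g₀ S + sgn true * hat g₁ S))
      ≈⟨ ∑₂-cong {m} (λ S → solve 4 (λ a b c d →
           (a :+ con 1ℤ :* b) :* (c :+ con 1ℤ :* d) :+ (a :+ con -1ℤ :* b) :* (c :+ con -1ℤ :* d)
           := con (+ 2) :* (a :* c :+ b :* d)) refl (hat f₀ S) (hat f₁ S) (hat g₀ S) (hat g₁ S)) ⟩
    ∑₂ (λ S → ι (+ 2) * (hat f₀ S * hat g₀ S + hat f₁ S * hat g₁ S))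
      ≈⟨ ∑₂-*ˡ {m} (ι (+ 2)) _ ⟩
    ι (+ 2) * ∑₂ (λ S → hat f₀ S * hat g₀ S + hat f₁ S * hat g₁ S)
      ≈⟨ *-congˡ (trans (∑₂-+ {m} _ _) (+-cong (parseval f₀ g₀) (parseval f₁ g₁))) ⟩
    ι (+ 2) * (2^ m * ∑₂ (λ x → f₀ x * g₀ x) + 2^ m * ∑₂ (λ x → f₁ x * g₁ x))
      ≈⟨ solve 4 (λ t p a b → t :* (p :* a :+ p :* b) := t :* p :* (a :+ b)) refl (ι (+ 2)) (2^ m) _ _ ⟩
    2^ (suc m) * ∑₂ (λ x → f x * g x) ∎
    where
    f₀ = f ∘ (false ∷_)
    f₁ = f ∘ (true ∷_)
    g₀ = g ∘ (false ∷_)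
    g₁ = g ∘ (true ∷_)

  infixl 7 _⋆_
  _⋆_ : ∀ {m} → (Vec Bool m → Carrier) → (Vec Bool m → Carrier) → Vec Bool m → Carrier
  (f ⋆ g) x = ∑₂ (λ z → f z * g (x ⊕ z))

  -- Diagonalises adjacency: convolution with the indicator of a connection set acts on each Fourier
  -- coefficient by a scalar, the eigenvalue.
  hat-⋆ : ∀ {m} (f g : Vec Bool m → Carrier) S → hat (f ⋆ g) S ≈ hat f S * hat g S
  hat-⋆ f g []      = refl
  hat-⋆ f g (b ∷ S) = begin
    hat (λ x → (f₀ ⋆ g₀) x + (f₁ ⋆ g₁) x) S + sgn b * hat (λ x → (f₀ ⋆ g₁) x + (f₁ ⋆ g₀) x) S
      ≈⟨ +-cong (trans (hat-+ (f₀ ⋆ g₀) (f₁ ⋆ g₁) S) (+-cong (hat-⋆ f₀ g₀ S) (hat-⋆ f₁ g₁ S)))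
                (*-congˡ (trans (hat-+ (f₀ ⋆ g₁) (f₁ ⋆ g₀) S) (+-cong (hat-⋆ f₀ g₁ S) (hat-⋆ f₁ g₀ S)))) ⟩
    hat f₀ S * hat g₀ S + hat f₁ S * hat g₁ S + sgn b * (hat f₀ S * hat g₁ S + hat f₁ S * hat g₀ S)
      ≈⟨ case b ⟩
    (hat f₀ S + sgn b * hat f₁ S) * (hat g₀ S + sgn b * hat g₁ S) ∎
    where
    f₀ = f ∘ (false ∷_)
    f₁ = f ∘ (true ∷_)
    g₀ = g ∘ (false ∷_)
    g₁ = g ∘ (true ∷_)
    case : ∀ b → hat f₀ S * hat g₀ S + hat f₁ S * hat g₁ S + sgn b * (hat f₀ S * hat g₁ S + hat f₁ S * hat g₀ S)
               ≈ (hat f₀ S + sgn b * hat f₁ S) * (hat g₀ S + sgn b * hat g₁ S)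
    case false = solve 4 (λ a b c d → a :* c :+ b :* d :+ con 1ℤ :* (a :* d :+ b :* c) := (a :+ con 1ℤ :* b) :* (c :+ con 1ℤ :* d)) refl _ _ _ _
    case true  = solve 4 (λ a b c d → a :* c :+ b :* d :+ con -1ℤ :* (a :* d :+ b :* c) := (a :+ con -1ℤ :* b) :* (c :+ con -1ℤ :* d)) refl _ _ _ _

  -- Translation by `x` multiplies the coefficient at `S` by the character value `χ x S`.
  hat-translate-zero : ∀ {m} (f : Vec Bool m → Carrier) x S → hat f S ≈ 0# → hat (λ z → f (x ⊕ z)) S ≈ 0#
  hat-translate-zero f x S eq = trans (lem f x S) (trans (*-congˡ eq) (zeroʳ (χ x S)))
    where
    χ : ∀ {m} → Vec Bool m → Vec Bool m → Carrier
    χ []          []      = ι 1ℤ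
    χ (false ∷ x) (b ∷ S) = χ x S
    χ (true ∷ x)  (b ∷ S) = sgn b * χ x S
    lem : ∀ {m} (f : Vec Bool m → Carrier) x S → hat (λ z → f (x ⊕ z)) S ≈ χ x S * hat f S
    lem f []          []      = trans (sym (*-identityˡ _)) (*-congʳ (sym ι-1))
    lem f (false ∷ x) (b ∷ S) = trans (+-cong (lem (f ∘ (false ∷_)) x S) (*-congˡ (lem (f ∘ (true ∷_)) x S)))
      (solve 4 (λ x a b s → x :* a :+ s :* (x :* b) := x :* (a :+ s :* b)) refl _ _ _ _)
    lem f (true ∷ x)  (b ∷ S) = trans (+-cong (lem (f ∘ (true ∷_)) x S) (*-congˡ (lem (f ∘ (false ∷_)) x S))) (case b)
      where
      case : ∀ b → χ x S * hat (f ∘ (true ∷_)) S + sgn b * (χ x S * hat (f ∘ (false ∷_)) S)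
                 ≈ sgn b * χ x S * (hat (f ∘ (false ∷_)) S + sgn b * hat (f ∘ (true ∷_)) S)
      case false = solve 3 (λ x a b → x :* b :+ con 1ℤ :* (x :* a) := con 1ℤ :* x :* (a :+ con 1ℤ :* b)) refl _ _ _
      case true  = solve 3 (λ x a b → x :* b :+ con -1ℤ :* (x :* a) := con -1ℤ :* x :* (a :+ con -1ℤ :* b)) refl _ _ _

  -- Transforms of the indicators of weight classes.

  ind : ∀ {m} → ℕ → Vec Bool m → Carrier
  ind zero    []          = ι 1ℤ
  ind (suc k) []          = 0#
  ind k       (false ∷ x) = ind k x
  ind zero    (true ∷ x)  = 0#
  ind (suc k) (true ∷ x)  = ind k x

  ind-weight : ∀ {m} (x : Vec Bool m) → ind (weight x) x ≈ 1#
  ind-weight []          = ι-1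
  ind-weight (false ∷ x) with weight x | ind-weight x
  ... | zero  | h = h
  ... | suc _ | h = h
  ind-weight (true ∷ x)  = ind-weight x

  ind-≢ : ∀ {m} k (x : Vec Bool m) → weight x ≢ k → ind k x ≈ 0#
  ind-≢ zero    []          ≢k = contradiction ≡.refl ≢k
  ind-≢ (suc k) []          ≢k = refl
  ind-≢ zero    (false ∷ x) ≢k = ind-≢ zero x ≢k
  ind-≢ (suc k) (false ∷ x) ≢k = ind-≢ (suc k) x ≢k
  ind-≢ zero    (true ∷ x)  ≢k = refl
  ind-≢ (suc k) (true ∷ x)  ≢k = ind-≢ k x (≢k ∘ ≡.cong suc)

  -- An entry `false` of `S` contributes a sign +1 and an entry `true` a sign -1, matching the two
  -- recursions of `K`; the second is `K-suc₂`.
  hat-ind : ∀ {m} k (S : Vec Bool m) → hat (ind k) S ≈ ι (K (zeros S) (weight S) k)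
  hat-ind zero    []          = refl
  hat-ind (suc k) []          = refl
  hat-ind zero    (false ∷ S) = trans (+-cong (hat-ind zero S) (*-congˡ (hat-zero (λ _ → refl) S)))
    (trans (+-congˡ (zeroʳ _)) (+-identityʳ _))
  hat-ind zero    (true ∷ S)  = trans (+-cong (hat-ind zero S) (*-congˡ (hat-zero (λ _ → refl) S)))
    (trans (+-congˡ (zeroʳ _)) (trans (+-identityʳ _)
      (reflexive (≡.cong ι (≡.trans (K-zero (zeros S) (weight S)) (≡.sym (K-zero (zeros S) (suc (weight S)))))))))
  hat-ind (suc k) (false ∷ S) = begin
    hat (ind (suc k)) S + ι 1ℤ * hat (ind k) S
      ≈⟨ +-cong (hat-ind (suc k) S) (trans (*-cong ι-1 (hat-ind k S)) (*-identityˡ _)) ⟩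
    ι (K (zeros S) (weight S) (suc k)) + ι (K (zeros S) (weight S) k)
      ≈⟨ ι-+ (K (zeros S) (weight S) (suc k)) _ ⟨
    ι (K (zeros S) (weight S) (suc k) ℤ.+ K (zeros S) (weight S) k) ∎
  hat-ind (suc k) (true ∷ S)  = begin
    hat (ind (suc k)) S + ι -1ℤ * hat (ind k) S
      ≈⟨ +-cong (hat-ind (suc k) S) (*-congˡ (hat-ind k S)) ⟩
    ι (K (zeros S) (weight S) (suc k)) + ι -1ℤ * ι (K (zeros S) (weight S) k)
      ≈⟨ +-congˡ (ι-* -1ℤ (K (zeros S) (weight S) k)) ⟨
    ι (K (zeros S) (weight S) (suc k)) + ι (-1ℤ ℤ.* K (zeros S) (weight S) k)
      ≈⟨ ι-+ (K (zeros S) (weight S) (suc k)) _ ⟨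
    ι (K (zeros S) (weight S) (suc k) ℤ.+ -1ℤ ℤ.* K (zeros S) (weight S) k)
      ≡⟨ ≡.cong (λ j → ι (K (zeros S) (weight S) (suc k) ℤ.+ j)) (ℤ.-1*i≡-i (K (zeros S) (weight S) k)) ⟩
    ι (K (zeros S) (weight S) (suc k) ℤ.- K (zeros S) (weight S) k)
      ≡⟨ ≡.cong ι (K-suc₂ (zeros S) (weight S) k) ⟨
    ι (K (zeros S) (suc (weight S)) (suc k)) ∎

  ∑₂-ind₀ : ∀ {m} (f : Vec Bool m → Carrier) → ∑₂ (λ z → ind 0 z * f z) ≈ f (replicate m false)
  ∑₂-ind₀ {zero}  f = trans (*-congʳ ι-1) (*-identityˡ _)
  ∑₂-ind₀ {suc m} f = begin
    ∑₂ (λ z → ind 0 z * f (false ∷ z)) + ∑₂ (λ z → 0# * f (true ∷ z))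
      ≈⟨ +-cong (∑₂-ind₀ (f ∘ (false ∷_))) (∑₂-*ˡ {m} 0# _) ⟩
    f (replicate (suc m) false) + 0# * ∑₂ (λ z → f (true ∷ z))
      ≈⟨ trans (+-congˡ (zeroˡ _)) (+-identityʳ _) ⟩
    f (replicate (suc m) false) ∎

  -- Functions whose spectrum lies on singletons and the full set.

  L : ∀ {n} → Vec Carrier n → Vec Bool n → Carrier
  L []       []      = 0#
  L (c ∷ cs) (b ∷ x) = sgn b * c + L cs x

  hat-supp-0 : ∀ {m} (F : Vec Bool m → Carrier) → (∀ S → weight S ≢ 0 → F S ≈ 0#) →
               ∀ x → hat F x ≈ F (replicate m false)
  hat-supp-0 F h []      = refl
  hat-supp-0 F h (b ∷ x) = trans (+-cong (hat-supp-0 (F ∘ (false ∷_)) (λ S → h (false ∷ S)) x)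
      (*-congˡ (hat-zero (λ S → h (true ∷ S) λ ()) x)))
    (trans (+-congˡ (zeroʳ _)) (+-identityʳ _))

  hat-supp-1 : ∀ {m} (F : Vec Bool m → Carrier) → (∀ S → weight S ≢ 1 → F S ≈ 0#) →
               ∃[ cs ] ∀ x → hat F x ≈ L cs x
  hat-supp-1 {zero}  F h = [] , λ { [] → h [] λ () }
  hat-supp-1 {suc m} F h with hat-supp-1 (F ∘ (false ∷_)) (λ S → h (false ∷ S))
  ... | cs , eq = F (true ∷ replicate m false) ∷ cs , λ { (b ∷ x) →
        trans (+-cong (eq x) (*-congˡ (hat-supp-0 (F ∘ (true ∷_)) (λ S ≢0 → h (true ∷ S) (≢0 ∘ ℕ.suc-injective)) x))) (+-comm _ _) }

  hat-supp-full : ∀ {m} (F : Vec Bool m → Carrier) → (∀ S → zeros S ≢ 0 → F S ≈ 0#) →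
                  ∀ x → hat F x ≈ sgn (par x) * F (replicate m true)
  hat-supp-full F h []      = trans (sym (*-identityˡ _)) (*-congʳ (sym ι-1))
  hat-supp-full {suc m} F h (b ∷ x) = begin
    hat (F ∘ (false ∷_)) x + sgn b * hat (F ∘ (true ∷_)) x
      ≈⟨ +-cong (hat-zero (λ S → h (false ∷ S) λ ()) x) (*-congˡ (hat-supp-full (F ∘ (true ∷_)) (λ S → h (true ∷ S)) x)) ⟩
    0# + sgn b * (sgn (par x) * F (replicate (suc m) true))
      ≈⟨ +-identityˡ _ ⟩
    sgn b * (sgn (par x) * F (replicate (suc m) true))
      ≈⟨ *-assoc _ _ _ ⟨
    sgn b * sgn (par x) * F (replicate (suc m) true)
      ≈⟨ *-congʳ (sgn-xor b (par x)) ⟨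
    sgn (b xor par x) * F (replicate (suc m) true) ∎

  select : ∀ {P : Set} → Dec P → Carrier → Carrier → Carrier
  select (yes _) x y = x
  select (no _)  x y = y

  -- Singletons give the coordinate characters of `x`, and the full set gives the sign of its
  -- parity. Restoring the parity bit as a coordinate makes all of them coordinate characters of
  -- `par x ∷ x`.
  hat-supp : ∀ {m} (F : Vec Bool m → Carrier) → (∀ S → weight S ≢ 1 → zeros S ≢ 0 → F S ≈ 0#) →
             ∃[ cs ] ∀ x → hat F x ≈ L cs (par x ∷ x)
  hat-supp {m} F h = F₂ (replicate m true) ∷ cs , λ x → begin
      hat F x                      ≈⟨ hat-cong F≈ x ⟩
      hat (λ S → F₂ S + F₁ S) x    ≈⟨ hat-+ F₂ F₁ x ⟩
      hat F₂ x + hat F₁ x          ≈⟨ +-cong (hat-supp-full F₂ F₂-supp x) (eq x) ⟩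
      sgn (par x) * F₂ (replicate m true) + L cs x ∎
    where
    -- Testing the weight first assigns each `S` to exactly one summand, also for `m = 1`, where the
    -- full set is a singleton.
    F₁ F₂ : Vec Bool m → Carrier
    F₁ S = select (weight S ℕ.≟ 1) (F S) 0#
    F₂ S = select (weight S ℕ.≟ 1) 0# (F S)
    F₁-supp : ∀ S → weight S ≢ 1 → F₁ S ≈ 0#
    F₁-supp S ≢1 with weight S ℕ.≟ 1
    ... | yes ≡1 = contradiction ≡1 ≢1
    ... | no  _  = refl
    F₂-supp : ∀ S → zeros S ≢ 0 → F₂ S ≈ 0#
    F₂-supp S ≢0 with weight S ℕ.≟ 1
    ... | yes _  = refl
    ... | no  ≢1 = h S ≢1 ≢0
    F≈ : ∀ S → F S ≈ F₂ S + F₁ S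
    F≈ S with weight S ℕ.≟ 1
    ... | yes _ = sym (+-identityˡ _)
    ... | no  _ = sym (+-identityʳ _)
    cs = proj₁ (hat-supp-1 F₁ F₁-supp)
    eq = proj₂ (hat-supp-1 F₁ F₁-supp)

-- Parity, and the vertices as lifts of ℤ₂ᵐ.

xor-cancelˡ : ∀ a b → a xor (a xor b) ≡ b
xor-cancelˡ false b = ≡.refl
xor-cancelˡ true  b = not-involutive b

xor-interchange : ∀ a b c d → (a xor b) xor (c xor d) ≡ (a xor c) xor (b xor d)
xor-interchange false false c     d = ≡.refl
xor-interchange false true  false d = ≡.refl
xor-interchange false true  true  d = ≡.refl
xor-interchange true  false false d = ≡.refl
xor-interchange true  false true  d = not-involutive d
xor-interchange true  true  false d = ≡.sym (not-involutive d)
xor-interchange true  true  true  d = ≡.refl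

par-⊕ : ∀ {m} (x y : Vec Bool m) → par (x ⊕ y) ≡ par x xor par y
par-⊕ []      []      = ≡.refl
par-⊕ (a ∷ x) (b ∷ y) = ≡.trans (≡.cong ((a xor b) xor_) (par-⊕ x y)) (xor-interchange a b (par x) (par y))

par-replicate-false : ∀ m → par (replicate m false) ≡ false
par-replicate-false zero    = ≡.refl
par-replicate-false (suc m) = par-replicate-false m

⊕-cancelˡ : ∀ {m} (x y : Vec Bool m) → x ⊕ (x ⊕ y) ≡ y
⊕-cancelˡ []      []      = ≡.refl
⊕-cancelˡ (a ∷ x) (b ∷ y) = ≡.cong₂ _∷_ (xor-cancelˡ a b) (⊕-cancelˡ x y)

⊕-identityʳ : ∀ {m} (x : Vec Bool m) → x ⊕ replicate m false ≡ x
⊕-identityʳ []      = ≡.refl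
⊕-identityʳ (a ∷ x) = ≡.cong₂ _∷_ (xor-identityʳ a) (⊕-identityʳ x)

par-weight : ∀ {m} (x : Vec Bool m) →
             (par x ≡ false → 2 ∣ weight x) × (par x ≡ true → 2 ∣ suc (weight x))
par-weight []          = (λ _ → 2 ∣0) , λ ()
par-weight (false ∷ x) = par-weight x
par-weight (true ∷ x) with par x | par-weight x
... | false | even , odd = (λ ()) , λ _ → ∣m∣n⇒∣m+n (∣-refl {2}) (even ≡.refl)
... | true  | even , odd = (λ _ → odd ≡.refl) , λ ()

even⇒par≡false : ∀ {m} (x : Vec Bool m) → 2 ∣ weight x → par x ≡ false
even⇒par≡false x 2∣w with par x | par-weight x
... | false | _       = ≡.refl
... | true  | _ , odd = contradiction (∣1⇒≡1 (∣m+n∣m⇒∣n (≡.subst (2 ∣_) (ℕ.+-comm 1 _) (odd ≡.refl)) 2∣w)) λ ()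

even⇒≡par : ∀ {m} b (x : Vec Bool m) → 2 ∣ weight (b ∷ x) → b ≡ par x
even⇒≡par b x 2∣w = lem b (par x) (even⇒par≡false (b ∷ x) 2∣w)
  where
  lem : ∀ b c → b xor c ≡ false → b ≡ c
  lem false false _ = ≡.refl
  lem true  true  _ = ≡.refl

Even : ℕ → Set
Even n = Refinement (Vec Bool n) (λ x → 2 ∣ weight x)

lift : ∀ {m} → Vec Bool m → Even (suc m)
lift z = par z ∷ z , irrelevant (proj₁ (par-weight (par z ∷ z)) (xor-same (par z)))

lift-surjective : ∀ {m} (v : Even (suc m)) → ∃[ z ] v ≡ lift z
-- The evenness proof is irrelevant, so the equation `b ≡ par z` derived from it is recovered
-- through its decidability.
lift-surjective (b ∷ z , irrelevant 2∣w) with recompute (b ≟ᵇ par z) (even⇒≡par b z 2∣w)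
... | ≡.refl = z , ≡.refl

-- Makes adjacency translation invariant: whether the lifts of `x` and `x ⊕ z` are adjacent depends
-- only on `z`.
lift-⊕ : ∀ {m} (x z : Vec Bool m) → value (lift x) ⊕ value (lift (x ⊕ z)) ≡ par z ∷ z
lift-⊕ x z = ≡.cong₂ _∷_ (≡.trans (≡.cong (par x xor_) (par-⊕ x z)) (xor-cancelˡ (par x) (par z))) (⊕-cancelˡ x z)

vec-of-weight : ∀ {m j} → j ℕ.≤ m → ∃[ x ] weight {m} x ≡ j
vec-of-weight {zero}  z≤n = [] , ≡.refl
vec-of-weight {suc m} {zero} z≤n with vec-of-weight {m} z≤n
... | x , eq = false ∷ x , eq
vec-of-weight (s≤s j≤m) with vec-of-weight j≤m
... | x , eq = true ∷ x , ≡.cong suc eq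

-- Linear forms in signs and their rigidity.

module Affine {c ℓ₁ ℓ₂} (ℝ : RealField c ℓ₁ ℓ₂) where
  open RealField ℝ hiding (zero)
  open RealFieldProperties ℝ
  open Walsh ℝ
  open SetoidReasoning setoid

  -- The witnesses differ only in coordinate `i`, which is `false` in `x` and `true` in `y`; only
  -- the effect on each `L cs` is recorded.
  toggle : ∀ {m} (i : Fin m) {j} → suc j ℕ.≤ m →
           ∃[ x ] ∃[ y ] weight x ≡ j × weight y ≡ suc j ×
             (∀ cs → L cs x ≈ L cs y + ι (+ 2) * lookup cs i)
  toggle zero (s≤s j≤m) with vec-of-weight j≤m
  ... | x , eq = false ∷ x , true ∷ x , eq , ≡.cong suc eq , λ { (c ∷ cs) →
          solve 2 (λ c l → con 1ℤ :* c :+ l := con -1ℤ :* c :+ l :+ con (+ 2) :* c) refl c (L cs x) }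
  toggle {suc (suc m)} (suc i) {zero} _ with toggle {suc m} i {zero} (s≤s z≤n)
  ... | x , y , eq , eq′ , h = false ∷ x , false ∷ y , eq , eq′ , λ { (c ∷ cs) →
          trans (+-congˡ (h cs)) (sym (+-assoc _ _ _)) }
  toggle (suc i) {suc j} (s≤s j<m) with toggle i j<m
  ... | x , y , eq , eq′ , h = true ∷ x , true ∷ y , ≡.cong suc eq , ≡.cong suc eq′ , λ { (c ∷ cs) →
          trans (+-congˡ (h cs)) (sym (+-assoc _ _ _)) }

  -- The sum of the signs of `x`. At `u ⊕ v` it is the inner product of the ±1 vectors of `u` and
  -- `v`.
  dev : ∀ {n} → Vec Bool n → Carrier
  dev x = ι (+ zeros x) - ι (+ weight x)

  dev-weight : ∀ {n} (x : Vec Bool n) → dev x ≈ ι (+ n) - ι (+ 2) * ι (+ weight x)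
  dev-weight {n} x = begin
    ι (+ zeros x) - ι (+ weight x)
      ≈⟨ solve 2 (λ z w → z :- w := z :+ w :- con (+ 2) :* w) refl _ _ ⟩
    ι (+ zeros x) + ι (+ weight x) - ι (+ 2) * ι (+ weight x)
      ≈⟨ +-congʳ (ι-+ (+ zeros x) (+ weight x)) ⟨
    ι (+ (zeros x ℕ.+ weight x)) - ι (+ 2) * ι (+ weight x)
      ≡⟨ ≡.cong (λ l → ι (+ l) - ι (+ 2) * ι (+ weight x)) (zeros+weight x) ⟩
    ι (+ n) - ι (+ 2) * ι (+ weight x) ∎

  dev-∷ : ∀ {n} b (x : Vec Bool n) → dev (b ∷ x) ≈ sgn b + dev x
  dev-∷ false x = trans (+-congʳ (ι-+ 1ℤ (+ zeros x)))
    (solve 2 (λ z w → con 1ℤ :+ z :- w := con 1ℤ :+ (z :- w)) refl _ _)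
  dev-∷ true  x = trans (+-congˡ (-‿cong (ι-+ 1ℤ (+ weight x))))
    (solve 2 (λ z w → z :- (con 1ℤ :+ w) := con -1ℤ :+ (z :- w)) refl _ _)

  dev-zeros : ∀ n → dev (replicate n false) ≈ ι (+ n)
  dev-zeros zero    = -‿inverseʳ 0#
  dev-zeros (suc n) = trans (dev-∷ false (replicate n false)) (trans (+-congˡ (dev-zeros n)) (sym (ι-+ 1ℤ (+ n))))

  L-const : ∀ {n} (cs : Vec Carrier n) c → (∀ i → lookup cs i ≈ c) → ∀ x → L cs x ≈ dev x * c
  L-const []       c h []      = solve 1 (λ c → con 0ℤ := (con 0ℤ :- con 0ℤ) :* c) refl c
  L-const (e ∷ cs) c h (b ∷ x) = begin
    sgn b * e + L cs x        ≈⟨ +-cong (*-congˡ (h zero)) (L-const cs c (h ∘ suc) x) ⟩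
    sgn b * c + dev x * c     ≈⟨ distribʳ c (sgn b) (dev x) ⟨
    (sgn b + dev x) * c       ≈⟨ *-congʳ (dev-∷ b x) ⟨
    dev (b ∷ x) * c           ∎

  -- Comparing L at two vectors of weight k that differ by a transposition of the
  -- coordinates 0 and i + 1 shows that all coefficients agree.
  L-rigid : ∀ {m k} (cs : Vec Carrier (suc m)) {v} → 1 ℕ.≤ k → k ℕ.≤ m →
            L cs (replicate (suc m) false) ≈ 1# →
            (∀ x → weight x ≡ k → L cs x ≈ v) →
            ∀ x → ι (+ suc m) * L cs x ≈ dev x
  L-rigid {m} (c ∷ cs) {v} (s≤s _) k≤m L0 Lv x = begin
    ι (+ suc m) * L (c ∷ cs) x        ≈⟨ *-congˡ (L-const (c ∷ cs) c const x) ⟩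
    ι (+ suc m) * (dev x * c)         ≈⟨ solve 3 (λ n d c → n :* (d :* c) := d :* (n :* c)) refl _ _ _ ⟩
    dev x * (ι (+ suc m) * c)         ≈⟨ *-congˡ nc≈1 ⟩
    dev x * 1#                        ≈⟨ *-identityʳ _ ⟩
    dev x                             ∎
    where
    const : ∀ i → lookup (c ∷ cs) i ≈ c
    const zero    = refl
    const (suc i) with toggle i k≤m
    ... | x , y , eq , eq′ , h = *-cancelˡ-0< (ι-pos {+ 2} (ℤ.+<+ (s≤s z≤n))) (begin
      ι (+ 2) * lookup cs i
        ≈⟨ solve 3 (λ e l c → con (+ 2) :* e := con (+ 2) :* c :+ ((con -1ℤ :* c :+ (l :+ con (+ 2) :* e)) :- (con 1ℤ :* c :+ l))) refl (lookup cs i) (L cs y) c ⟩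
      ι (+ 2) * c + ((ι -1ℤ * c + (L cs y + ι (+ 2) * lookup cs i)) - (ι 1ℤ * c + L cs y))
        ≈⟨ +-congˡ (+-congʳ (+-congˡ (h cs))) ⟨
      ι (+ 2) * c + (L (c ∷ cs) (true ∷ x) - L (c ∷ cs) (false ∷ y))
        ≈⟨ +-congˡ (+-cong (Lv (true ∷ x) (≡.cong suc eq)) (-‿cong (Lv (false ∷ y) eq′))) ⟩
      ι (+ 2) * c + (v - v)
        ≈⟨ trans (+-congˡ (-‿inverseʳ v)) (+-identityʳ _) ⟩
      ι (+ 2) * c ∎)
    nc≈1 : ι (+ suc m) * c ≈ 1#
    nc≈1 = begin
      ι (+ suc m) * c                        ≈⟨ *-congʳ (dev-zeros (suc m)) ⟨
      dev (replicate (suc m) false) * c      ≈⟨ L-const (c ∷ cs) c const (replicate (suc m) false) ⟨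
      L (c ∷ cs) (replicate (suc m) false)   ≈⟨ L0 ⟩
      1#                                     ∎

-- The eigenvalues of the graph.

module Rigidity {c ℓ₁ ℓ₂} (ℝ : RealField c ℓ₁ ℓ₂) (m j : ℕ)
  (n+2≤2k : suc m ℕ.+ 2 ℕ.≤ 2 ℕ.* (j ℕ.+ j)) (k<n : j ℕ.+ j ℕ.< suc m) where
  open RealField ℝ hiding (zero)
  open RealFieldProperties ℝ
  open Walsh ℝ
  open Affine ℝ
  open KrawtchoukGap (suc m) j n+2≤2k k<n
  open SemiringSum semiring using (sum-cong-≋; *-distribˡ-sum; *-distribʳ-sum)
  open SetoidReasoning setoid

  private
    n = suc m
    k = j ℕ.+ j

  0<ιn : 0# < ι (+ n)
  0<ιn = ι-pos {+ n} (ℤ.+<+ (s≤s z≤n))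

  open Graph (H n k)

  sum-nonneg : ∀ {d} {f : Vector Carrier d} → (∀ i → 0# ≤ f i) → 0# ≤ sum f
  sum-nonneg {zero}  h = ≤-refl
  sum-nonneg {suc d} h = 0≤x+y (h zero) (sum-nonneg (h ∘ suc))

  ⟨u,u⟩≈0⇒u≈0 : ∀ {d} (u : Vector Carrier d) → ⟨ u , u ⟩ ≈ 0# → ∀ i → u i ≈ 0#
  ⟨u,u⟩≈0⇒u≈0 {suc d} u eq zero    =
    x*x≈0⇒x≈0 (x+y≈0⇒x≈0 (0≤x*x (u zero)) (sum-nonneg (λ i → 0≤x*x (u (suc i)))) eq)
  ⟨u,u⟩≈0⇒u≈0 {suc d} u eq (suc i) = ⟨u,u⟩≈0⇒u≈0 (u ∘ suc)
    (x+y≈0⇒x≈0 (sum-nonneg (λ i → 0≤x*x (u (suc i)))) (0≤x*x (u zero)) (trans (+-comm _ _) eq)) i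

  -- The indicator of the connection set: k being even, only the summand with the parity bit of z
  -- can be nonzero.
  a : Vec Bool m → Carrier
  a z = ind k (false ∷ z) + ind k (true ∷ z)

  1≤k : 1 ℕ.≤ k
  1≤k = ℕ.n≢0⇒n>0 λ k≡0 → contradiction (≡.subst (λ k → n ℕ.+ 2 ℕ.≤ 2 ℕ.* k) k≡0 n+2≤2k) λ ()

  2∣k : 2 ∣ k
  2∣k = divides j (≡.trans (≡.cong (j ℕ.+_) (≡.sym (ℕ.+-identityʳ j))) (ℕ.*-comm 2 j))

  a-cases : ∀ z → (weight (par z ∷ z) ≡ k × a z ≈ 1#) ⊎ (weight (par z ∷ z) ≢ k × a z ≈ 0#)
  a-cases z with weight (par z ∷ z) ℕ.≟ k
  ... | no ≢k  = inj₂ (≢k , trans (+-cong (off false) (off true)) (+-identityˡ 0#))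
    where
    off : ∀ b → ind k (b ∷ z) ≈ 0#
    off b = ind-≢ k (b ∷ z) λ eq → ≢k (≡.subst (λ b → weight (b ∷ z) ≡ k)
      (even⇒≡par b z (≡.subst (2 ∣_) (≡.sym eq) 2∣k)) eq)
  ... | yes eq = inj₁ (eq , on (par z) ≡.refl eq)
    where
    off : ∀ b → b ≢ par z → ind k (b ∷ z) ≈ 0#
    off b b≢ = ind-≢ k (b ∷ z) λ eq → b≢ (even⇒≡par b z (≡.subst (2 ∣_) (≡.sym eq) 2∣k))
    ind≈1 : ∀ b → weight (b ∷ z) ≡ k → ind k (b ∷ z) ≈ 1#
    ind≈1 b eq = trans (reflexive (≡.cong (λ l → ind l (b ∷ z)) (≡.sym eq))) (ind-weight (b ∷ z))
    on : ∀ b → b ≡ par z → weight (b ∷ z) ≡ k → a z ≈ 1#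
    on false eq w = trans (+-cong (ind≈1 false w) (off true λ eq′ → contradiction (≡.trans eq (≡.sym eq′)) λ ())) (+-identityʳ 1#)
    on true  eq w = trans (+-cong (off false λ eq′ → contradiction (≡.trans eq (≡.sym eq′)) λ ()) (ind≈1 true w)) (+-identityˡ 1#)

  -- Summing over the deleted coordinate amounts to evaluating the transform of `ind k` on ℤ₂ⁿ at
  -- `false ∷ S`.
  hat-a : ∀ S → hat a S ≈ ι (K (suc (zeros S)) (weight S) k)
  hat-a S = begin
    hat a S
      ≈⟨ hat-+ (ind k ∘ (false ∷_)) (ind k ∘ (true ∷_)) S ⟩
    hat (ind k ∘ (false ∷_)) S + hat (ind k ∘ (true ∷_)) S
      ≈⟨ +-congˡ (trans (*-congʳ ι-1) (*-identityˡ _)) ⟨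
    hat (ind k) (false ∷ S)
      ≈⟨ hat-ind k (false ∷ S) ⟩
    ι (K (suc (zeros S)) (weight S) k) ∎

  κ : Carrier
  κ = ι (ℤ.- X₁)

  -- Adding `κ` at the zero vector shifts every eigenvalue by `- X₁`, so that the least one becomes
  -- 0.
  b : Vec Bool m → Carrier
  b z = a z + κ * ind 0 z

  gapℤ : Vec Bool m → ℤ
  gapℤ S = K (suc (zeros S)) (weight S) k ℤ.- X₁

  hat-b : ∀ S → hat b S ≈ ι (gapℤ S)
  hat-b S = begin
    hat b S
      ≈⟨ hat-+ a (λ z → κ * ind 0 z) S ⟩
    hat a S + hat (λ z → κ * ind 0 z) S
      ≈⟨ +-cong (hat-a S) (trans (hat-*ˡ κ (ind 0) S) (*-congˡ (hat-ind 0 S))) ⟩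
    ι (K (suc (zeros S)) (weight S) k) + κ * ι (K (zeros S) (weight S) 0)
      ≡⟨ ≡.cong (λ i → ι (K (suc (zeros S)) (weight S) k) + κ * ι i) (K-zero (zeros S) (weight S)) ⟩
    ι (K (suc (zeros S)) (weight S) k) + κ * ι 1ℤ
      ≈⟨ +-congˡ (trans (*-congˡ ι-1) (*-identityʳ κ)) ⟩
    ι (K (suc (zeros S)) (weight S) k) + κ
      ≈⟨ ι-+ (K (suc (zeros S)) (weight S) k) (ℤ.- X₁) ⟨
    ι (gapℤ S) ∎

  -- Among all `n` coordinates there are `suc (zeros S)` positive signs, so the exception `a = 1` of
  -- `gap` is the full set.
  gapℤ-pos : ∀ S → weight S ≢ 1 → zeros S ≢ 0 → 0ℤ ℤ.< gapℤ S
  gapℤ-pos S ≢1 ≢0 = <⇒0<- (gap (suc (zeros S)) (weight S) (≡.cong suc (zeros+weight S)) (≢0 ∘ ℕ.suc-injective) ≢1)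

  gapℤ-nonneg : ∀ S → 0ℤ ℤ.≤ gapℤ S
  gapℤ-nonneg S with weight S ℕ.≟ 1 | zeros S ℕ.≟ 0
  ... | no ≢1  | no ≢0  = ℤ.<⇒≤ (gapℤ-pos S ≢1 ≢0)
  ... | yes ≡1 | _      = ℤ.i≤j⇒0≤j-i (ℤ.≤-reflexive (≡.sym (≡.trans (≡.cong (λ w → K (suc (zeros S)) w k) ≡1)
        (K₁≡X₁ (suc (zeros S)) (≡.trans (≡.cong (suc (zeros S) ℕ.+_) (≡.sym ≡1)) (≡.cong suc (zeros+weight S)))))))
  ... | no _   | yes ≡0 = ℤ.i≤j⇒0≤j-i (ℤ.≤-reflexive (≡.sym (≡.trans (≡.cong (λ z → K (suc z) (weight S) k) ≡0)
        (¹K≡X₁ (weight S) (≡.cong suc (≡.trans (≡.cong (ℕ._+ weight S) (≡.sym ≡0)) (zeros+weight S)))))))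

  0≤hat-b : ∀ S → 0# ≤ hat b S
  0≤hat-b S = ≤-respʳ-≈ (sym (hat-b S)) (ι-nonneg (gapℤ-nonneg S))

  module _ {ρ : Carrier} (nρ≈M : ι (+ n) * ρ ≈ ι M) where

    -- `∑₂ a` is the degree, which is the eigenvalue `K n 0 k`; by `rec₀` the least eigenvalue is
    -- `- M / n` times it.
    κ≈ρ∑a : κ ≈ ρ * ∑₂ a
    κ≈ρ∑a = *-cancelˡ-0< 0<ιn (begin
      ι (+ n) * ι (ℤ.- X₁)             ≈⟨ ι-* (+ n) (ℤ.- X₁) ⟨
      ι (+ n ℤ.* (ℤ.- X₁))             ≡⟨ ≡.cong ι eq ⟩
      ι (M ℤ.* K n 0 k)                ≈⟨ ι-* M (K n 0 k) ⟩
      ι M * ι (K n 0 k)                ≈⟨ *-cong nρ≈M ∑a ⟨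
      ι (+ n) * ρ * ∑₂ a               ≈⟨ *-assoc _ _ _ ⟩
      ι (+ n) * (ρ * ∑₂ a)             ∎)
      where
      eq : + n ℤ.* (ℤ.- X₁) ≡ M ℤ.* K n 0 k
      eq = ≡.trans (≡.sym (ℤ.neg-distribʳ-* (+ n) X₁))
           (≡.trans (≡.cong ℤ.-_ (≡.trans rec₀ (≡.sym (ℤ.neg-distribˡ-* M (K n 0 k))))) (ℤ.neg-involutive _))
      zeros-0 : ∀ l → zeros (replicate l false) ≡ l
      zeros-0 zero    = ≡.refl
      zeros-0 (suc l) = ≡.cong suc (zeros-0 l)
      weight-0 : ∀ l → weight (replicate l false) ≡ 0
      weight-0 zero    = ≡.refl
      weight-0 (suc l) = weight-0 l
      ∑a : ∑₂ a ≈ ι (K n 0 k)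
      ∑a = trans (sym (hat-0 a)) (trans (hat-a (replicate m false))
        (reflexive (≡.cong₂ (λ z w → ι (K (suc z) w k)) (zeros-0 m) (weight-0 m))))

    -- Spectral balance of a colouring with edge bound -ρ.

    module _ {d : ℕ} (p : Even n → Vector Carrier d)
             (unit : ∀ v → ⟨ p v , p v ⟩ ≈ 1#)
             (adjacent : ∀ u v → u ∼ v → ⟨ p u , p v ⟩ ≤ - ρ) where

      f : Fin d → Vec Bool m → Carrier
      f i x = p (lift x) i

      E : Vec Bool m → Vec Bool m → Carrier
      E x z = ⟨ p (lift x) , p (lift (x ⊕ z)) ⟩

      p̂ : Vec Bool m → Vector Carrier d
      p̂ S i = hat (f i) S

      E-0 : ∀ x → E x (replicate m false) ≈ 1#
      E-0 x = trans (reflexive (≡.cong (λ y → ⟨ p (lift x) , p (lift y) ⟩) (⊕-identityʳ x))) (unit (lift x))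

      E-adjacent : ∀ x z → weight (par z ∷ z) ≡ k → E x z ≤ - ρ
      E-adjacent x z eq = adjacent (lift x) (lift (x ⊕ z)) (≡.trans (≡.cong weight (lift-⊕ x z)) eq)

      -- In each coordinate of ℝᵈ, multiplication by `hat b` is convolution with `b`, and Parseval
      -- moves the sum back to the vertices.
      plancherel : ∑₂ (λ S → hat b S * ⟨ p̂ S , p̂ S ⟩) ≈ 2^ m * ∑₂ (λ x → ∑₂ (λ z → b z * E x z))
      plancherel = begin
        ∑₂ (λ S → hat b S * ⟨ p̂ S , p̂ S ⟩)
          ≈⟨ ∑₂-cong {m} (λ S → trans (*-distribˡ-sum (hat b S) (λ i → p̂ S i * p̂ S i)) (sum-cong-≋ (λ i →
               trans (sym (*-assoc (hat b S) (p̂ S i) (p̂ S i))) (*-congʳ (sym (hat-⋆ b (f i) S)))))) ⟩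
        ∑₂ (λ S → sum (λ i → hat (b ⋆ f i) S * hat (f i) S))
          ≈⟨ ∑₂-sum (λ S i → hat (b ⋆ f i) S * hat (f i) S) ⟩
        sum (λ i → ∑₂ (λ S → hat (b ⋆ f i) S * hat (f i) S))
          ≈⟨ sum-cong-≋ (λ i → parseval (b ⋆ f i) (f i)) ⟩
        sum (λ i → 2^ m * ∑₂ (λ x → (b ⋆ f i) x * f i x))
          ≈⟨ *-distribˡ-sum (2^ m) (λ i → ∑₂ (λ x → (b ⋆ f i) x * f i x)) ⟨
        2^ m * sum (λ i → ∑₂ (λ x → (b ⋆ f i) x * f i x))
          ≈⟨ *-congˡ (∑₂-sum (λ x i → (b ⋆ f i) x * f i x)) ⟨
        2^ m * ∑₂ (λ x → sum (λ i → (b ⋆ f i) x * f i x))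
          ≈⟨ *-congˡ (∑₂-cong {m} pointwise) ⟩
        2^ m * ∑₂ (λ x → ∑₂ (λ z → b z * E x z)) ∎
        where
        pointwise : ∀ x → sum (λ i → (b ⋆ f i) x * f i x) ≈ ∑₂ (λ z → b z * E x z)
        pointwise x = begin
          sum (λ i → (b ⋆ f i) x * f i x)
            ≈⟨ sum-cong-≋ (λ i → trans (*-comm _ (f i x)) (sym (∑₂-*ˡ (f i x) (λ z → b z * f i (x ⊕ z))))) ⟩
          sum (λ i → ∑₂ (λ z → f i x * (b z * f i (x ⊕ z))))
            ≈⟨ ∑₂-sum (λ z i → f i x * (b z * f i (x ⊕ z))) ⟨
          ∑₂ (λ z → sum (λ i → f i x * (b z * f i (x ⊕ z))))
            ≈⟨ ∑₂-cong {m} (λ z → trans (sum-cong-≋ (λ i →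
                 solve 3 (λ u b v → u :* (b :* v) := b :* (u :* v)) refl (f i x) (b z) (f i (x ⊕ z))))
                 (sym (*-distribˡ-sum (b z) (λ i → f i x * f i (x ⊕ z))))) ⟩
          ∑₂ (λ z → b z * E x z) ∎

      -- The slack in the edge bound, masked to the connection set by `a`.
      D : Vec Bool m → Vec Bool m → Carrier
      D x z = a z * (- ρ - E x z)

      0≤D : ∀ x z → 0# ≤ D x z
      0≤D x z with a-cases z
      ... | inj₂ (_ , a≈0)  = ≤-reflexive (sym (trans (*-congʳ a≈0) (zeroˡ _)))
      ... | inj₁ (eq , a≈1) = ≤-respʳ-≈ (sym (trans (*-congʳ a≈1) (*-identityˡ _))) (x≤y⇒0≤y-x (E-adjacent x z eq))

      -- The products of `a` and `E` cancel. What remains is `κ`, from the unit norm at `z = 0`,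
      -- minus `ρ` times the degree.
      ∑bE : ∀ x → ∑₂ (λ z → b z * E x z) + ∑₂ (D x) ≈ 0#
      ∑bE x = begin
        ∑₂ (λ z → b z * E x z) + ∑₂ (D x)
          ≈⟨ ∑₂-+ (λ z → b z * E x z) (D x) ⟨
        ∑₂ (λ z → b z * E x z + D x z)
          ≈⟨ ∑₂-cong {m} (λ z → solve 5 (λ a κ i r e → (a :+ κ :* i) :* e :+ a :* (:- r :- e) := κ :* (i :* e) :+ :- r :* a) refl
                           (a z) κ (ind 0 z) ρ (E x z)) ⟩
        ∑₂ (λ z → κ * (ind 0 z * E x z) + - ρ * a z)
          ≈⟨ ∑₂-+ {m} (λ z → κ * (ind 0 z * E x z)) (λ z → - ρ * a z) ⟩
        ∑₂ (λ z → κ * (ind 0 z * E x z)) + ∑₂ (λ z → - ρ * a z)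
          ≈⟨ +-cong (∑₂-*ˡ κ (λ z → ind 0 z * E x z)) (∑₂-*ˡ (- ρ) a) ⟩
        κ * ∑₂ (λ z → ind 0 z * E x z) + - ρ * ∑₂ a
          ≈⟨ +-congʳ (*-cong κ≈ρ∑a (trans (∑₂-ind₀ (E x)) (E-0 x))) ⟩
        ρ * ∑₂ a * 1# + - ρ * ∑₂ a
          ≈⟨ +-congʳ (*-identityʳ _) ⟩
        ρ * ∑₂ a + - ρ * ∑₂ a
          ≈⟨ solve 2 (λ r s → r :* s :+ :- r :* s := con 0ℤ) refl ρ (∑₂ a) ⟩
        0# ∎

      -- The weighted spectral energy and the total slack are both nonnegative, so every term of
      -- either vanishes; this yields `p̂≈0` and `D≈0`.
      balance : ∑₂ (λ S → hat b S * ⟨ p̂ S , p̂ S ⟩) + 2^ m * ∑₂ (λ x → ∑₂ (D x)) ≈ 0#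
      balance = begin
        ∑₂ (λ S → hat b S * ⟨ p̂ S , p̂ S ⟩) + 2^ m * ∑₂ (λ x → ∑₂ (D x))
          ≈⟨ +-congʳ plancherel ⟩
        2^ m * ∑₂ (λ x → ∑₂ (λ z → b z * E x z)) + 2^ m * ∑₂ (λ x → ∑₂ (D x))
          ≈⟨ distribˡ (2^ m) _ _ ⟨
        2^ m * (∑₂ (λ x → ∑₂ (λ z → b z * E x z)) + ∑₂ (λ x → ∑₂ (D x)))
          ≈⟨ *-congˡ (trans (sym (∑₂-+ (λ x → ∑₂ (λ z → b z * E x z)) (λ x → ∑₂ (D x)))) (trans (∑₂-cong {m} ∑bE) ∑₂-0)) ⟩
        2^ m * 0#
          ≈⟨ zeroʳ _ ⟩
        0# ∎
        where
        ∑₂-0 : ∑₂ {m} (λ _ → 0#) ≈ 0#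
        ∑₂-0 = trans (sym (hat-0 {m} (λ _ → 0#))) (hat-zero (λ _ → refl) (replicate m false))

      0≤spectral : ∀ S → 0# ≤ hat b S * ⟨ p̂ S , p̂ S ⟩
      0≤spectral S = 0≤x*y (0≤hat-b S) (sum-nonneg (λ i → 0≤x*x (p̂ S i)))

      0≤∑D : 0# ≤ 2^ m * ∑₂ (λ x → ∑₂ (D x))
      0≤∑D = 0≤x*y (<⇒≤ (0<2^ m)) (∑₂-nonneg (λ x → ∑₂-nonneg (0≤D x)))

      p̂≈0 : ∀ S → weight S ≢ 1 → zeros S ≢ 0 → ∀ i → p̂ S i ≈ 0#
      p̂≈0 S ≢1 ≢0 = ⟨u,u⟩≈0⇒u≈0 (p̂ S) (*-cancelˡ-0< 0<hat-b (trans
        (∑₂-nonneg-zero 0≤spectral (x+y≈0⇒x≈0 (∑₂-nonneg 0≤spectral) 0≤∑D balance) S) (sym (zeroʳ _))))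
        where
        0<hat-b : 0# < hat b S
        0<hat-b = <-respʳ-≈ (sym (hat-b S)) (ι-pos (gapℤ-pos S ≢1 ≢0))

      D≈0 : ∀ x z → D x z ≈ 0#
      D≈0 x = ∑₂-nonneg-zero (0≤D x) (∑₂-nonneg-zero (λ x → ∑₂-nonneg (0≤D x))
        (*-cancelˡ-0< (0<2^ m) (trans (x+y≈0⇒x≈0 0≤∑D (∑₂-nonneg 0≤spectral) (trans (+-comm _ _) balance)) (sym (zeroʳ _)))) x)

      E-tight : ∀ x z → weight (par z ∷ z) ≡ k → E x z ≈ - ρ
      E-tight x z eq with a-cases z
      ... | inj₁ (_ , a≈1) = begin
        E x z                        ≈⟨ solve 2 (λ r e → e := :- r :- con 1ℤ :* (:- r :- e)) refl ρ (E x z) ⟩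
        - ρ - ι 1ℤ * (- ρ - E x z)   ≈⟨ +-congˡ (-‿cong (trans (*-congʳ (trans ι-1 (sym a≈1))) (D≈0 x z))) ⟩
        - ρ - 0#                     ≈⟨ trans (+-congˡ -0#≈0#) (+-identityʳ _) ⟩
        - ρ                          ∎
      ... | inj₂ (≢k , _) = contradiction eq ≢k

      -- For fixed `x`, `E x` is a linear combination of translates of the functions `f i`, and
      -- translation does not enlarge the spectral support.
      hat-E≈0 : ∀ x S → weight S ≢ 1 → zeros S ≢ 0 → hat (E x) S ≈ 0#
      hat-E≈0 x S ≢1 ≢0 = begin
        hat (E x) S
          ≈⟨ hat-sum (λ z i → f i x * f i (x ⊕ z)) S ⟩
        sum (λ i → hat (λ z → f i x * f i (x ⊕ z)) S)
          ≈⟨ sum-cong-≋ (λ i → trans (hat-*ˡ (f i x) (λ z → f i (x ⊕ z)) S)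
               (*-congˡ (hat-translate-zero (f i) x S (p̂≈0 S ≢1 ≢0 i)))) ⟩
        sum (λ i → f i x * 0#)
          ≈⟨ *-distribʳ-sum 0# (λ i → f i x) ⟨
        sum (λ i → f i x) * 0#
          ≈⟨ zeroʳ _ ⟩
        0# ∎

      -- Fourier inversion and the spectral support turn `E x` into a form `L cs`; its values at
      -- weights 0 and `k` determine it by `L-rigid`.
      gram : ∀ x z → ι (+ n) * E x z ≈ dev (par z ∷ z)
      gram x z = trans (*-congˡ (E≈L z)) (L-rigid cs 1≤k (ℕ.s≤s⁻¹ k<n)
          (trans (reflexive (≡.cong (λ b → L cs (b ∷ replicate m false)) (≡.sym (par-replicate-false m))))
                 (trans (sym (E≈L (replicate m false))) (E-0 x)))
          -- As `k` is even, every vector of weight `k` has the form `par y ∷ y`, where `L cs`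
          -- agrees with `E x`.
          (λ { (b ∷ y) eq → edge b y (even⇒≡par b y (≡.subst (2 ∣_) (≡.sym eq) 2∣k)) eq })
          (par z ∷ z))
        where
        2^-m : Carrier
        2^-m = 0<x⇒inverse (2^ m) (0<2^ m)
        supp = hat-supp (λ S → 2^-m * hat (E x) S) (λ S ≢1 ≢0 → trans (*-congˡ (hat-E≈0 x S ≢1 ≢0)) (zeroʳ _))
        cs = proj₁ supp
        E≈L : ∀ z → E x z ≈ L cs (par z ∷ z)
        E≈L z = begin
          E x z                             ≈⟨ *-identityˡ _ ⟨
          1# * E x z                        ≈⟨ *-congʳ (0<x⇒inverseʳ (2^ m) (0<2^ m)) ⟨
          2^ m * 2^-m * E x z               ≈⟨ solve 3 (λ t i e → t :* i :* e := i :* (t :* e)) refl (2^ m) 2^-m (E x z) ⟩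
          2^-m * (2^ m * E x z)             ≈⟨ *-congˡ (hat-hat (E x) z) ⟨
          2^-m * hat (hat (E x)) z          ≈⟨ hat-*ˡ 2^-m (hat (E x)) z ⟨
          hat (λ S → 2^-m * hat (E x) S) z  ≈⟨ proj₂ supp z ⟩
          L cs (par z ∷ z)                  ∎
        edge : ∀ b y → b ≡ par y → weight (b ∷ y) ≡ k → L cs (b ∷ y) ≈ - ρ
        edge b y ≡.refl eq = trans (sym (E≈L y)) (E-tight x y eq)

      gram-dev : ∀ u v → ι (+ n) * ⟨ p u , p v ⟩ ≈ dev (value u ⊕ value v)
      gram-dev u v with lift-surjective u | lift-surjective v
      ... | x , ≡.refl | y , ≡.refl = ≡.subst (λ w → ι (+ n) * ⟨ p (lift x) , p (lift w) ⟩ ≈ dev (value (lift x) ⊕ value (lift w)))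
        (⊕-cancelˡ x y) (trans (gram x (x ⊕ y)) (reflexive (≡.cong dev (≡.sym (lift-⊕ x (x ⊕ y))))))

  -- An explicit colouring by scaled ±1 vectors.

  ν μ : Carrier
  ν = 0<x⇒inverse (ι (+ n)) 0<ιn
  0<ιM : 0# < ι M
  0<ιM = ι-pos (ℤ.<-≤-trans {j = + 2} (ℤ.+<+ (s≤s z≤n)) 2≤M)
  μ = 0<x⇒inverse (ι M) 0<ιM

  prepend : ∀ {d} r → Carrier → Vector Carrier d → Vector Carrier (r ℕ.+ d)
  prepend zero    s v = v
  prepend (suc r) s v = s Vector.∷ prepend r s v

  ⟨prepend,prepend⟩ : ∀ {d} r s t (u v : Vector Carrier d) →
    ⟨ prepend r s u , prepend r t v ⟩ ≈ ι (+ r) * (s * t) + ⟨ u , v ⟩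
  ⟨prepend,prepend⟩ zero    s t u v = sym (trans (+-congʳ (zeroˡ _)) (+-identityˡ _))
  ⟨prepend,prepend⟩ (suc r) s t u v = begin
    s * t + ⟨ prepend r s u , prepend r t v ⟩
      ≈⟨ +-congˡ (⟨prepend,prepend⟩ r s t u v) ⟩
    s * t + (ι (+ r) * (s * t) + ⟨ u , v ⟩)
      ≈⟨ solve 3 (λ x r y → x :+ (r :* x :+ y) := (con 1ℤ :+ r) :* x :+ y) refl (s * t) (ι (+ r)) ⟨ u , v ⟩ ⟩
    (ι 1ℤ + ι (+ r)) * (s * t) + ⟨ u , v ⟩
      ≈⟨ +-congʳ (*-congʳ (ι-+ 1ℤ (+ r))) ⟨
    ι (+ suc r) * (s * t) + ⟨ u , v ⟩ ∎

  -- n copies of ±1/n instead of one ±1/√n, so that no square root is needed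
  embed : ∀ {l} → Vec Bool l → Vector Carrier (l ℕ.* n)
  embed []      = Vector.[]
  embed (b ∷ x) = prepend n (sgn b * ν) (embed x)

  n⟨embed,embed⟩ : ∀ {l} (x y : Vec Bool l) → ι (+ n) * ⟨ embed x , embed y ⟩ ≈ dev (x ⊕ y)
  n⟨embed,embed⟩ []      []      = trans (zeroʳ _) (sym (-‿inverseʳ 0#))
  n⟨embed,embed⟩ (b ∷ x) (c ∷ y) = begin
    ι (+ n) * ⟨ embed (b ∷ x) , embed (c ∷ y) ⟩
      ≈⟨ *-congˡ (⟨prepend,prepend⟩ n (sgn b * ν) (sgn c * ν) (embed x) (embed y)) ⟩
    ι (+ n) * (ι (+ n) * (sgn b * ν * (sgn c * ν)) + ⟨ embed x , embed y ⟩)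
      ≈⟨ solve 5 (λ n b c v e → n :* (n :* (b :* v :* (c :* v)) :+ e) := (n :* v) :* (n :* v) :* (b :* c) :+ n :* e) refl
           (ι (+ n)) (sgn b) (sgn c) ν ⟨ embed x , embed y ⟩ ⟩
    ι (+ n) * ν * (ι (+ n) * ν) * (sgn b * sgn c) + ι (+ n) * ⟨ embed x , embed y ⟩
      ≈⟨ +-cong (*-cong (*-cong nν≈1 nν≈1) (sym (sgn-xor b c))) (n⟨embed,embed⟩ x y) ⟩
    1# * 1# * sgn (b xor c) + dev (x ⊕ y)
      ≈⟨ +-congʳ (trans (*-congʳ (*-identityˡ 1#)) (*-identityˡ _)) ⟩
    sgn (b xor c) + dev (x ⊕ y)
      ≈⟨ dev-∷ (b xor c) (x ⊕ y) ⟨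
    dev ((b xor c) ∷ (x ⊕ y)) ∎
    where
    nν≈1 : ι (+ n) * ν ≈ 1#
    nν≈1 = 0<x⇒inverseʳ (ι (+ n)) 0<ιn

  -- Chosen to make `1/(T - 1)` equal to `M / n`, the negative of the inner product that `embed`
  -- gives to adjacent vertices.
  T : Carrier
  T = 1# + ι (+ n) * μ

  2≤T : 2# ≤ T
  2≤T = x-y≤0⇒x≤y (≤-respˡ-≈ eq (x≤y⇒x-y≤0 (0≤x*y (ι-nonneg {+ n ℤ.- M} (ℤ.<⇒≤ (<⇒0<- M<N))) (0≤inverse (ι M) 0<ιM))))
    where
    eq : 0# - ι (+ n ℤ.- M) * μ ≈ 2# - T
    eq = begin
      0# - ι (+ n ℤ.- M) * μ
        ≈⟨ +-congˡ (-‿cong (*-congʳ (trans (ι-+ (+ n) (ℤ.- M)) (+-congˡ (ι-neg M))))) ⟩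
      0# - (ι (+ n) - ι M) * μ
        ≈⟨ solve 3 (λ n m i → con 0ℤ :- (n :- m) :* i := m :* i :- n :* i) refl (ι (+ n)) (ι M) μ ⟩
      ι M * μ - ι (+ n) * μ
        ≈⟨ +-congʳ (0<x⇒inverseʳ (ι M) 0<ιM) ⟩
      1# - ι (+ n) * μ
        ≈⟨ solve 2 (λ o x → o :- x := o :+ o :- (o :+ x)) refl 1# (ι (+ n) * μ) ⟩
      2# - T ∎

  1/[t-1]-inverse : ∀ t (2≤t : 2# ≤ t) → (t - 1#) * 1/[ t -1] 2≤t ≈ 1#
  1/[t-1]-inverse t 2≤t = proj₂ (proj₂ (#⇒invertible {t} {1#} (inj₂ (2≤t⇒1<t 2≤t))))

  -- The opposite strict inequality, multiplied by the positive numbers `s - 1#` and `t - 1#`, would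
  -- give `t < s`.
  1/[t-1]-antitone : ∀ {s t} (2≤s : 2# ≤ s) (2≤t : 2# ≤ t) → s ≤ t → 1/[ t -1] 2≤t ≤ 1/[ s -1] 2≤s
  1/[t-1]-antitone {s} {t} 2≤s 2≤t s≤t r<R = s≤t (0<y-x⇒x<y (<-respʳ-≈ eq
      (*-pos (*-pos (x<y⇒0<y-x (2≤t⇒1<t 2≤s)) (x<y⇒0<y-x (2≤t⇒1<t 2≤t))) (x<y⇒0<y-x r<R))))
    where
    r = 1/[ s -1] 2≤s
    R = 1/[ t -1] 2≤t
    eq : (s - 1#) * (t - 1#) * (R - r) ≈ s - t
    eq = begin
      (s - 1#) * (t - 1#) * (R - r)
        ≈⟨ solve 4 (λ s t R r → s :* t :* (R :- r) := s :* (t :* R) :- t :* (s :* r)) refl (s - 1#) (t - 1#) R r ⟩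
      (s - 1#) * ((t - 1#) * R) - (t - 1#) * ((s - 1#) * r)
        ≈⟨ +-cong (*-congˡ (1/[t-1]-inverse t 2≤t)) (-‿cong (*-congˡ (1/[t-1]-inverse s 2≤s))) ⟩
      (s - 1#) * 1# - (t - 1#) * 1#
        ≈⟨ +-cong (*-identityʳ _) (-‿cong (*-identityʳ _)) ⟩
      s - 1# - (t - 1#)
        ≈⟨ solve 3 (λ s t o → s :- o :- (t :- o) := s :- t) refl s t 1# ⟩
      s - t ∎

  ρ : Carrier
  ρ = 1/[ T -1] 2≤T

  nρ≈M : ι (+ n) * ρ ≈ ι M
  nρ≈M = begin
    ι (+ n) * ρ                   ≈⟨ *-identityˡ _ ⟨
    1# * (ι (+ n) * ρ)            ≈⟨ *-congʳ (0<x⇒inverseʳ (ι M) 0<ιM) ⟨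
    ι M * μ * (ι (+ n) * ρ)       ≈⟨ solve 5 (λ m i n r o → m :* i :* (n :* r) := m :* ((o :+ n :* i :- o) :* r)) refl (ι M) μ (ι (+ n)) ρ 1# ⟩
    ι M * ((T - 1#) * ρ)          ≈⟨ *-congˡ (1/[t-1]-inverse T 2≤T) ⟩
    ι M * 1#                      ≈⟨ *-identityʳ _ ⟩
    ι M                           ∎

  open VectorColoring ℝ (H n k) hiding (UniquelyVectorColorable)

  embed-coloring : IsVectorColoring T (embed ∘ value)
  embed-coloring = record
    { 2≤t      = 2≤T
    ; unit     = λ v → *-cancelˡ-0< 0<ιn (trans (n⟨embed,embed⟩ (value v) (value v)) (trans (dev-self (value v)) (sym (*-identityʳ _))))
    ; adjacent = λ u v eq → ≤-reflexive (*-cancelˡ-0< 0<ιn (edge u v eq))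
    }
    where
    dev-self : ∀ {l} (x : Vec Bool l) → dev (x ⊕ x) ≈ ι (+ l)
    dev-self {l} x = trans (reflexive (≡.cong dev (⊕-self x))) (dev-zeros l)
      where
      ⊕-self : ∀ {l} (x : Vec Bool l) → x ⊕ x ≡ replicate l false
      ⊕-self []      = ≡.refl
      ⊕-self (b ∷ x) = ≡.cong₂ _∷_ (xor-same b) (⊕-self x)
    edge : ∀ u v → u ∼ v → ι (+ n) * ⟨ embed (value u) , embed (value v) ⟩ ≈ ι (+ n) * (- ρ)
    edge u v eq = begin
      ι (+ n) * ⟨ embed (value u) , embed (value v) ⟩
        ≈⟨ n⟨embed,embed⟩ (value u) (value v) ⟩
      dev (value u ⊕ value v)
        ≈⟨ dev-weight (value u ⊕ value v) ⟩
      ι (+ n) - ι (+ 2) * ι (+ weight (value u ⊕ value v))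
        ≡⟨ ≡.cong (λ w → ι (+ n) - ι (+ 2) * ι (+ w)) eq ⟩
      ι (+ n) - ι (+ 2) * ι (+ k)
        ≈⟨ solve 2 (λ n k → n :- con (+ 2) :* k := :- (con (+ 2) :* k :- n)) refl (ι (+ n)) (ι (+ k)) ⟩
      - (ι (+ 2) * ι (+ k) - ι (+ n))
        ≈⟨ -‿cong (trans (ι-+ (+ 2 ℤ.* + k) (ℤ.- + n)) (+-cong (ι-* (+ 2) (+ k)) (ι-neg (+ n)))) ⟨
      - ι M
        ≈⟨ -‿cong nρ≈M ⟨
      - (ι (+ n) * ρ)
        ≈⟨ -‿distribʳ-* _ _ ⟩
      ι (+ n) * (- ρ) ∎

  -- Minimality against the colouring `embed` gives `t ≤ T`, so edges of `p` obey the bound `- ρ`.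
  -- The resulting Gram matrix no longer mentions `p`, hence uniqueness.
  optimal-gram : ∀ {d} (p : Even n → Vector Carrier d) → IsOptimal p →
                 ∀ u v → ι (+ n) * ⟨ p u , p v ⟩ ≈ dev (value u ⊕ value v)
  optimal-gram p (t , (_ , minimal) , coloring) = gram-dev nρ≈M p unit λ u v u∼v →
      ≤-trans (adjacent u v u∼v) (neg-antitone (1/[t-1]-antitone 2≤t 2≤T (minimal T (_ , _ , embed-coloring))))
    where
    open IsVectorColoring coloring
    neg-antitone : ∀ {x y} → x ≤ y → - y ≤ - x
    neg-antitone {x} {y} x≤y = x-y≤0⇒x≤y (≤-respˡ-≈ (solve 2 (λ x y → x :- y := :- y :- :- x) refl x y) (x≤y⇒x-y≤0 x≤y))

  unique : UniquelyVectorColorable ℝ (H n k)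
  unique p q p-opt q-opt u v = *-cancelˡ-0< 0<ιn (trans (optimal-gram p p-opt u v) (sym (optimal-gram q q-opt u v)))

open import Data.Nat.Base using (NonZero; _+_; _*_; _∸_; _≤_)

theorem3p9 : ∀ {c ℓ₁ ℓ₂} (ℝ : RealField c ℓ₁ ℓ₂) (n k : ℕ) .{{_ : NonZero n}} →
    2 ∣ k → n + 2 ≤ 2 * k → k ≤ n ∸ 1 →
    UniquelyVectorColorable ℝ (H n k)
theorem3p9 ℝ (suc m) k (divides j k≡j*2) n+2≤2k k≤m
  -- Rewrites `k` as `j + j`, the form of evenness on which `K-swap` rests.
  with ≡.refl ← ≡.trans k≡j*2 (≡.trans (ℕ.*-comm j 2) (≡.cong (j ℕ.+_) (ℕ.+-identityʳ j)))
  = Rigidity.unique ℝ m j n+2≤2k (s≤s k≤m)
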